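{- Let $t\geq 4$ and let $q=q(d)\geq 1-e^{ -t}$. Let $R$ be the random polytope $P_{d,q}\subseteq\mathbb{R}^d$. Then with high probability (as $d\to\infty$), for every $B\subseteq V(G_R)$ with $|B|\leq \tfrac34\cdot 2^d$, \[ e_{G_R}(B,B^{\mathsf c})\geq \frac{|B|}{8}\log_2\!\left(\frac{2^d}{|B|}\right), \] where $B^{\mathsf c}=V(G_R)\setminus B$.
   Context: $P_{d,q}$ is the convex hull of a random subset of $\{0,1\}^d$ in which each point is included independently with probability $q$; its vertex set is that random subset. $G_R$ is the graph of $R$: vertices are the $0$-faces and edges the $1$-faces of $R$. $e_G(S,T)$ is the number of edges between $S$ and $T$. The convention $0\cdot\log_2(2^d/0)=0$ is used when $B=\emptyset$.
   Formalization: The probability q(d) and the parameter t are taken to be rational numbers rather than real numbers. -}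

module Defs where

open import Data.Bool using (Bool; true; false)
open import Data.Nat as ℕ using (ℕ; zero; suc)
open import Data.Integer using (+_)
open import Data.Rational as ℚ using (ℚ; 0ℚ; 1ℚ; _+_; _*_; _-_)
open import Data.Vec using (Vec; []; _∷_)
open import Data.List using (List; []; _∷_; [_]; map; _++_; length)
open import Data.List.Membership.Propositional using (_∈_; _∉_)
open import Data.List.Relation.Unary.All using (All)
open import Data.List.Relation.Unary.Unique.Propositional using (Unique)
open import Data.Product using (Σ; ∃; _×_; _,_)
open import Relation.Binary.PropositionalEquality using (_≡_; _≢_)

Point : ℕ → Set
Point d = Vec Bool d

cube : (d : ℕ) → List (Point d)
cube zero = [ [] ]
cube (suc d) = map (false ∷_) (cube d) ++ map (true ∷_) (cube d)

sublists : {A : Set} → List A → List (List A)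
sublists [] = [ [] ]
sublists (x ∷ xs) = sublists xs ++ map (x ∷_) (sublists xs)

_^ℚ_ : ℚ → ℕ → ℚ
p ^ℚ zero = 1ℚ
p ^ℚ suc n = p * (p ^ℚ n)

dot : {d : ℕ} → Vec ℚ d → Point d → ℚ
dot [] [] = 0ℚ
dot (c ∷ cs) (false ∷ xs) = dot cs xs
dot (c ∷ cs) (true ∷ xs) = c + dot cs xs

-- Graph of R = conv(S) for S ⊆ {0,1}^d.  Every point of S is a vertex of R
-- (0/1 points are always extreme).  {u,v} is an edge (1-face) iff some linear
-- functional c attains its maximum over R exactly on conv{u,v}, i.e. u,v are
-- exactly the points of S maximising c.
IsEdge : {d : ℕ} → List (Point d) → Point d → Point d → Set
IsEdge {d} S u v =
  u ∈ S × v ∈ S × u ≢ v ×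
  Σ (Vec ℚ d) λ c →
    dot c u ≡ dot c v ×
    (∀ w → w ∈ S → w ≢ u → w ≢ v → dot c w ℚ.< dot c u)

-- e_{G_R}(B, S \ B) ≥ m : there are m distinct ordered pairs (u,v) with
-- u ∈ B, v ∈ S \ B and uv an edge of G_R.  (Each edge between B and its
-- complement gives exactly one such pair.)
EdgesAcrossAtLeast : {d : ℕ} → List (Point d) → List (Point d) → ℕ → Set
EdgesAcrossAtLeast {d} S B m =
  Σ (List (Point d × Point d)) λ L →
    length L ≡ m × Unique L ×
    All (λ { (u , v) → u ∈ B × v ∈ S × v ∉ B × IsEdge S u v }) L

-- The event of the theorem, for the vertex set S of R.
-- The inequality e ≥ (|B|/8) log₂(2^d/|B|) is written in the equivalent
-- exponentiated form 2^(d·|B|) ≤ 2^(8e) · |B|^|B|  (for |B| = 0 both sides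
-- are trivially true, matching the convention 0·log(2^d/0) = 0).
-- |B| ≤ (3/4)·2^d is written 4|B| ≤ 3·2^d.
GoodExpansion : (d : ℕ) → List (Point d) → Set
GoodExpansion d S =
  ∀ B → B ∈ sublists S →
    4 ℕ.* length B ℕ.≤ 3 ℕ.* (2 ℕ.^ d) →
    ∃ λ m → EdgesAcrossAtLeast S B m ×
      2 ℕ.^ (d ℕ.* length B) ℕ.≤ (2 ℕ.^ (8 ℕ.* m)) ℕ.* (length B ℕ.^ length B)

weight : (d : ℕ) → ℚ → List (Point d) → ℚ
weight d q S = (q ^ℚ length S) * ((1ℚ - q) ^ℚ (2 ℕ.^ d ℕ.∸ length S))

select : {A : Set} → List Bool → List A → List A
select [] _ = []
select (_ ∷ _) [] = []
select (true ∷ bs) (x ∷ xs) = x ∷ select bs xs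
select (false ∷ bs) (x ∷ xs) = select bs xs

sumℚ : List ℚ → ℚ
sumℚ [] = 0ℚ
sumℚ (x ∷ xs) = x + sumℚ xs

-- Pr_{S ~ P_{d,q}} [ E S ] ≥ p : some collection of outcomes, all lying in
-- the event E, has total probability at least p.
ProbAtLeast : (d : ℕ) → ℚ → (List (Point d) → Set) → ℚ → Set
ProbAtLeast d q E p =
  Σ (List Bool) λ sel →
    length sel ≡ length (sublists (cube d)) ×
    All E (select sel (sublists (cube d))) ×
    p ℚ.≤ sumℚ (map (weight d q) (select sel (sublists (cube d))))

expTerm : ℚ → ℕ → ℚ
expTerm t zero = 1ℚ
expTerm t (suc k) = expTerm t k * (t * ((+ 1) ℚ./ suc k))

expPartial : ℚ → ℕ → ℚ
expPartial t zero = 0ℚ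
expPartial t (suc n) = expPartial t n + expTerm t n

-- q ≥ 1 - e^{-t}, for q ≤ 1 and t ≥ 0, written as (1 - q)·e^t ≤ 1, i.e.
-- (1 - q)·(every partial sum of e^t) ≤ 1.
AboveOneMinusExpNeg : ℚ → ℚ → Set
AboveOneMinusExpNeg t q = ∀ n → (1ℚ - q) * expPartial t n ℚ.≤ 1ℚ

{-# OPTIONS --safe #-}
-- Two cube points at distance one that both survive span an edge of R; so do two points at
-- distance two with a missing common neighbour, hence the neighbours of a missing point form
-- a clique.  With high probability every point has fewer than d/3 missing neighbours and at
-- most a tenth of all points is missing (exponential moments and a union bound; here
-- 1 - q ≤ 1/54 is enough).  Given B, let A be B together with the missing points that have
-- no neighbour in S \ B.  By the edge-isoperimetric inequality of the cube the cut of A has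
-- at least |A| log₂(2^d/|A|) cube edges.  Those ending in a missing point are charged to
-- cliques at that point or, when it has no neighbour in B, to squares with a side between B
-- and S \ B, so the cut of A has at most 4 e(B, S \ B) edges.  Finally |A|² ≤ 2^d |B|, which
-- lets A be replaced by B for another factor 2.
module Submission where

open import Defs
open import Algebra.Bundles using (CommutativeRing; CommutativeSemiring)
open import Data.Bool using (Bool; true; false; not; _xor_)
open import Data.Bool.Properties as Bool
  using (not-involutive; not-¬; xor-same; xor-identityʳ; not-distribʳ-xor; xor-assoc)
open import Data.Fin using (Fin; zero; suc)
import Data.Fin.Properties as Fin
import Data.Integer as ℤ
import Data.Integer.Properties as ℤ
open import Data.List using (List; []; _∷_; map; _++_; length; filter; allFin; cartesianProduct)
import Data.List.Membership.DecPropositional as DecMembership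
open import Data.List.Membership.Propositional using (_∈_; _∉_; find; lose)
open import Data.List.Membership.Propositional.Properties
  using (∈-++⁻; ∈-++⁺ˡ; ∈-++⁺ʳ; ∈-map⁻; ∈-map⁺; ∈-filter⁻; ∈-allFin)
open import Data.List.Properties using (length-++; length-map; map-tabulate)
open import Data.List.Relation.Unary.All as All using (All)
import Data.List.Relation.Unary.All.Properties as All
open import Data.List.Relation.Unary.AllPairs using ([]; _∷_)
open import Data.List.Relation.Unary.Any using (Any; any?; here; there)
open import Data.List.Relation.Unary.Unique.Propositional using (Unique)
import Data.List.Relation.Unary.Unique.Propositional.Properties as Unique
open import Data.Nat
  using (ℕ; zero; suc; _+_; _*_; _^_; _∸_; _≤_; _<_; z≤n; s≤s; s≤s⁻¹; NonZero; >-nonZero)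
open import Data.Nat.Properties
open import Data.Nat.Tactic.RingSolver using (solve-∀)
open import Data.Product using (∃; _×_; _,_; proj₁; proj₂)
open import Data.Rational as ℚ using (ℚ; 0ℚ; 1ℚ; mkℚ; toℚᵘ)
import Data.Rational.Properties as ℚ
open import Data.Rational.Solver using (module +-*-Solver)
import Data.Rational.Unnormalised as ℚᵘ
import Data.Rational.Unnormalised.Properties as ℚᵘ
open import Data.Sum using (_⊎_; inj₁; inj₂)
open import Data.Vec using (Vec; []; _∷_; head; tail; replicate; zipWith)
open import Data.Vec.Properties using (≡-dec)
open import Function using (_∘_; id)
open import Level using (0ℓ)
open import Relation.Binary.Definitions using (DecidableEquality)
open import Relation.Binary.PropositionalEquality
open import Relation.Nullary using (¬_; Dec; does; yes; no; ¬?; contradiction; _×-dec_; _⊎-dec_)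
open import Relation.Nullary.Decidable using (from-yes)
open import Relation.Unary using (Decidable)

-- Sums over the cube and its edge-isoperimetric inequality

-- Where the missing points are placed decides what can be charged. A missing point outside A pays
-- for its edges with the product of its numbers of neighbours in B and in the rest of S. Without a
-- neighbour in the rest of S this product is zero, so such a point has to go into A. This may
-- enlarge B by half, and since (3/2)² · 3/4 > 1 the degree bound alone does not give |A|² ≤ 2^d |B|
-- for large B; hence the second bound, on the total number of missing points. The factor 4 in the
-- charging is a 2 for the two kinds of cut edges at a missing point, to B and to other missing
-- points, times a 2 because both common neighbours of a pair at distance two may be missing. With
-- Chernoff parameter 27 the union bound over 2^d points leaves (2/3 · (1 + 26p))^d for p = 1 - q.
-- This decays once p < 1/52, and e⁴ > 54 supplies that. Sets enter as 0/1 functions with values in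
-- ℕ, so every charging argument is an exchange of finite sums.

module Summation (R : CommutativeSemiring 0ℓ 0ℓ) where
  private module R = CommutativeSemiring R
  open R using (Carrier; _≈_; 0#) renaming (_+_ to _⊕_; _*_ to _⊗_)
  open import Algebra.Properties.CommutativeSemigroup R.+-commutativeSemigroup
    using (interchange)

  ∑ : {A : Set} → List A → (A → Carrier) → Carrier
  ∑ []       f = 0#
  ∑ (x ∷ xs) f = f x ⊕ ∑ xs f

  syntax ∑ xs (λ x → e) = ∑[ x ← xs ] e

  ∑-cong-∈ : {A : Set} (xs : List A) {f g : A → Carrier} →
             (∀ {x} → x ∈ xs → f x ≈ g x) → ∑ xs f ≈ ∑ xs g
  ∑-cong-∈ []       eq = R.refl
  ∑-cong-∈ (x ∷ xs) eq = R.+-cong (eq (here refl)) (∑-cong-∈ xs (eq ∘ there))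

  ∑-cong : {A : Set} (xs : List A) {f g : A → Carrier} →
           (∀ x → f x ≈ g x) → ∑ xs f ≈ ∑ xs g
  ∑-cong xs eq = ∑-cong-∈ xs (λ {x} _ → eq x)

  ∑-++ : {A : Set} (xs ys : List A) (f : A → Carrier) →
         ∑ (xs ++ ys) f ≈ ∑ xs f ⊕ ∑ ys f
  ∑-++ []       ys f = R.sym (R.+-identityˡ _)
  ∑-++ (x ∷ xs) ys f =
    R.trans (R.+-congˡ (∑-++ xs ys f)) (R.sym (R.+-assoc _ _ _))

  ∑-map : {A B : Set} (h : A → B) (xs : List A) (f : B → Carrier) →
          ∑ (map h xs) f ≈ ∑ xs (f ∘ h)
  ∑-map h []       f = R.refl
  ∑-map h (x ∷ xs) f = R.+-congˡ (∑-map h xs f)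

  ∑-+ : {A : Set} (xs : List A) (f g : A → Carrier) →
        ∑[ x ← xs ] (f x ⊕ g x) ≈ ∑ xs f ⊕ ∑ xs g
  ∑-+ []       f g = R.sym (R.+-identityˡ _)
  ∑-+ (x ∷ xs) f g =
    R.trans (R.+-congˡ (∑-+ xs f g)) (interchange _ _ _ _)

  ∑-*ˡ : {A : Set} (xs : List A) (c : Carrier) (f : A → Carrier) →
         ∑[ x ← xs ] (c ⊗ f x) ≈ c ⊗ ∑ xs f
  ∑-*ˡ []       c f = R.sym (R.zeroʳ c)
  ∑-*ˡ (x ∷ xs) c f =
    R.trans (R.+-congˡ (∑-*ˡ xs c f)) (R.sym (R.distribˡ c _ _))

  ∑-0 : {A : Set} (xs : List A) → ∑[ _ ← xs ] 0# ≈ 0#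
  ∑-0 []       = R.refl
  ∑-0 (x ∷ xs) = R.trans (R.+-identityˡ _) (∑-0 xs)

  ∑-swap : {A B : Set} (xs : List A) (ys : List B) (f : A → B → Carrier) →
           ∑[ x ← xs ] ∑[ y ← ys ] f x y ≈ ∑[ y ← ys ] ∑[ x ← xs ] f x y
  ∑-swap []       ys f = R.sym (∑-0 ys)
  ∑-swap (x ∷ xs) ys f =
    R.trans (R.+-congˡ (∑-swap xs ys f)) (R.sym (∑-+ ys _ _))

open Summation +-*-commutativeSemiring

∑-mono-∈ : {A : Set} (xs : List A) {f g : A → ℕ} →
           (∀ {x} → x ∈ xs → f x ≤ g x) → ∑ xs f ≤ ∑ xs g
∑-mono-∈ []       le = z≤n
∑-mono-∈ (x ∷ xs) le = +-mono-≤ (le (here refl)) (∑-mono-∈ xs (le ∘ there))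

∑-mono : {A : Set} (xs : List A) {f g : A → ℕ} →
         (∀ x → f x ≤ g x) → ∑ xs f ≤ ∑ xs g
∑-mono xs le = ∑-mono-∈ xs (λ {x} _ → le x)

∑-term-∈ : {A : Set} {xs : List A} {x : A} (f : A → ℕ) → x ∈ xs → f x ≤ ∑ xs f
∑-term-∈ f (here refl) = m≤m+n _ _
∑-term-∈ f (there x∈)  = ≤-trans (∑-term-∈ f x∈) (m≤n+m _ _)

∑-*ʳ : {A : Set} (xs : List A) (f : A → ℕ) (c : ℕ) →
       ∑[ x ← xs ] (f x * c) ≡ ∑ xs f * c
∑-*ʳ xs f c = trans (∑-cong xs (λ x → *-comm (f x) c))
                    (trans (∑-*ˡ xs c f) (*-comm c _))

∑-cube : ∀ d (f : Point (suc d) → ℕ) →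
         ∑ (cube (suc d)) f ≡
         ∑[ u ← cube d ] f (false ∷ u) + ∑[ u ← cube d ] f (true ∷ u)
∑-cube d f = trans (∑-++ (map (false ∷_) (cube d)) (map (true ∷_) (cube d)) f)
  (cong₂ _+_ (∑-map (false ∷_) (cube d) f) (∑-map (true ∷_) (cube d) f))

∑-allFin : ∀ d (f : Fin (suc d) → ℕ) →
           ∑ (allFin (suc d)) f ≡ f zero + ∑[ i ← allFin d ] f (suc i)
∑-allFin d f = cong (f zero +_)
  (trans (cong (λ is → ∑ is f) (sym (map-tabulate id suc)))
         (∑-map suc (allFin d) f))

∑-allFin-1 : ∀ d → ∑[ _ ← allFin d ] 1 ≡ d
∑-allFin-1 zero    = refl
∑-allFin-1 (suc d) = trans (∑-allFin d (λ _ → 1)) (cong suc (∑-allFin-1 d))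

∑-cube-1 : ∀ d → ∑[ _ ← cube d ] 1 ≡ 2 ^ d
∑-cube-1 zero    = refl
∑-cube-1 (suc d) = trans (∑-cube d (λ _ → 1))
  (trans (cong₂ _+_ (∑-cube-1 d) (∑-cube-1 d))
         (cong (2 ^ d +_) (sym (+-identityʳ (2 ^ d)))))

-- Coordinate flips and balls of radius one and two

flip : ∀ {d} → Fin d → Point d → Point d
flip zero    (x ∷ u) = not x ∷ u
flip (suc i) (x ∷ u) = x ∷ flip i u

flip-involutive : ∀ {d} (i : Fin d) u → flip i (flip i u) ≡ u
flip-involutive zero    (x ∷ u) = cong (_∷ u) (not-involutive x)
flip-involutive (suc i) (x ∷ u) = cong (x ∷_) (flip-involutive i u)

flip-comm : ∀ {d} (i j : Fin d) u → flip i (flip j u) ≡ flip j (flip i u)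
flip-comm zero    zero    (x ∷ u) = refl
flip-comm zero    (suc j) (x ∷ u) = refl
flip-comm (suc i) zero    (x ∷ u) = refl
flip-comm (suc i) (suc j) (x ∷ u) = cong (x ∷_) (flip-comm i j u)

∑-flip : ∀ {d} (i : Fin d) (f : Point d → ℕ) →
         ∑[ u ← cube d ] f (flip i u) ≡ ∑ (cube d) f
∑-flip {suc d} zero    f = trans (∑-cube d (f ∘ flip zero))
  (trans (+-comm (∑[ u ← cube d ] f (true ∷ u)) _) (sym (∑-cube d f)))
∑-flip {suc d} (suc i) f = trans (∑-cube d (f ∘ flip (suc i)))
  (trans (cong₂ _+_ (∑-flip i (f ∘ (false ∷_))) (∑-flip i (f ∘ (true ∷_))))
         (sym (∑-cube d f)))

∑-term : ∀ {d} (u : Point d) (f : Point d → ℕ) → f u ≤ ∑ (cube d) f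
∑-term {zero}  []          f = m≤m+n _ 0
∑-term {suc d} (false ∷ u) f rewrite ∑-cube d f =
  ≤-trans (∑-term u (f ∘ (false ∷_))) (m≤m+n _ _)
∑-term {suc d} (true ∷ u)  f rewrite ∑-cube d f =
  ≤-trans (∑-term u (f ∘ (true ∷_))) (m≤n+m _ _)

∑-cube-at : ∀ {d} (x : Bool) (f : Point (suc d) → ℕ) →
            ∑ (cube (suc d)) f ≡
            ∑[ u ← cube d ] f (x ∷ u) + ∑[ u ← cube d ] f (not x ∷ u)
∑-cube-at {d} false f = ∑-cube d f
∑-cube-at {d} true  f = trans (∑-cube d f) (+-comm (∑[ u ← cube d ] f (false ∷ u)) _)

-- The points of a ball of radius one are distinct. The induction sees this without an injectivity
-- argument: all of the ball lies in the half of the centre, except for the single flip of the first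
-- coordinate.
∑-ball₁ : ∀ {d} (u : Point d) (f : Point d → ℕ) →
          f u + ∑[ i ← allFin d ] f (flip i u) ≤ ∑ (cube d) f
∑-ball₁ {zero}  []      f = ≤-refl
∑-ball₁ {suc d} (x ∷ u) f = begin
  f (x ∷ u) + ∑[ i ← allFin (suc d) ] f (flip i (x ∷ u))
    ≡⟨ cong (f (x ∷ u) +_) (∑-allFin d _) ⟩
  f (x ∷ u) + (f (not x ∷ u) + ∑[ i ← allFin d ] f (x ∷ flip i u))
    ≡⟨ rearrange (f (x ∷ u)) (f (not x ∷ u)) _ ⟩
  (f (x ∷ u) + ∑[ i ← allFin d ] f (x ∷ flip i u)) + f (not x ∷ u)
    ≤⟨ +-mono-≤ (∑-ball₁ u (f ∘ (x ∷_))) (∑-term u (f ∘ (not x ∷_))) ⟩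
  ∑[ v ← cube d ] f (x ∷ v) + ∑[ v ← cube d ] f (not x ∷ v)
    ≡⟨ ∑-cube-at x f ⟨
  ∑ (cube (suc d)) f ∎
  where
  open ≤-Reasoning
  rearrange : ∀ a b c → a + (b + c) ≡ (a + c) + b
  rearrange = solve-∀

-- Every point at distance two is reached by exactly two ordered pairs of
-- flips, and u itself by the d pairs with i ≡ j.
∑-ball₂ : ∀ {d} (u : Point d) (f : Point d → ℕ) →
          2 * ∑[ i ← allFin d ] f (flip i u) +
          ∑[ i ← allFin d ] ∑[ j ← allFin d ] f (flip j (flip i u))
          ≤ 2 * ∑ (cube d) f + d * f u
∑-ball₂ {zero}  []      f = z≤n
∑-ball₂ {suc d} (x ∷ u) f = begin
  2 * ∑[ i ← allFin (suc d) ] f (flip i (x ∷ u)) +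
  ∑[ i ← allFin (suc d) ] ∑[ j ← allFin (suc d) ] f (flip j (flip i (x ∷ u)))
    ≡⟨ cong₂ (λ s t → 2 * s + t) (∑-allFin d (λ i → f (flip i (x ∷ u)))) two-steps ⟩
  2 * (f̄ u + F₁) + ((f (not (not x) ∷ u) + F̄₁) + (F̄₁ + F₂))
    ≡⟨ cong (λ y → 2 * (f̄ u + F₁) + ((f (y ∷ u) + F̄₁) + (F̄₁ + F₂))) (not-involutive x) ⟩
  2 * (f̄ u + F₁) + ((f (x ∷ u) + F̄₁) + (F̄₁ + F₂))
    ≡⟨ rearrange₁ (f̄ u) F₁ (f (x ∷ u)) F̄₁ F₂ ⟩
  (2 * F₁ + F₂) + 2 * (f̄ u + F̄₁) + f (x ∷ u)
    ≤⟨ +-monoˡ-≤ (f (x ∷ u)) (+-mono-≤ (∑-ball₂ u (f ∘ (x ∷_)))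
                                        (*-monoʳ-≤ 2 (∑-ball₁ u f̄))) ⟩
  (2 * ∑ (cube d) (f ∘ (x ∷_)) + d * f (x ∷ u)) + 2 * ∑ (cube d) f̄ + f (x ∷ u)
    ≡⟨ rearrange₂ (∑ (cube d) (f ∘ (x ∷_))) (d * f (x ∷ u)) (∑ (cube d) f̄) (f (x ∷ u)) ⟩
  2 * (∑ (cube d) (f ∘ (x ∷_)) + ∑ (cube d) f̄) + suc d * f (x ∷ u)
    ≡⟨ cong (λ s → 2 * s + suc d * f (x ∷ u)) (∑-cube-at x f) ⟨
  2 * ∑ (cube (suc d)) f + suc d * f (x ∷ u) ∎
  where
  open ≤-Reasoning
  f̄ : Point d → ℕ
  f̄ = f ∘ (not x ∷_)
  F₁ F̄₁ F₂ : ℕ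
  F₁ = ∑[ i ← allFin d ] f (x ∷ flip i u)
  F̄₁ = ∑[ i ← allFin d ] f̄ (flip i u)
  F₂ = ∑[ i ← allFin d ] ∑[ j ← allFin d ] f (x ∷ flip j (flip i u))
  two-steps : ∑[ i ← allFin (suc d) ] ∑[ j ← allFin (suc d) ] f (flip j (flip i (x ∷ u)))
              ≡ (f (not (not x) ∷ u) + F̄₁) + (F̄₁ + F₂)
  two-steps = trans (∑-allFin d _) (cong₂ _+_ (∑-allFin d _)
    (trans (∑-cong (allFin d) (λ i → ∑-allFin d (λ j → f (flip j (x ∷ flip i u)))))
           (∑-+ (allFin d) _ _)))
  rearrange₁ : ∀ a b c e g → 2 * (a + b) + ((c + e) + (e + g)) ≡ (2 * b + g) + 2 * (a + e) + c
  rearrange₁ = solve-∀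
  rearrange₂ : ∀ a b c e → (2 * a + b) + 2 * c + e ≡ 2 * (a + c) + (e + b)
  rearrange₂ = solve-∀

-- The two-point inequality and edge-isoperimetry

*-^-distrib : ∀ m n k → (m * n) ^ k ≡ m ^ k * n ^ k
*-^-distrib m n zero    = refl
*-^-distrib m n (suc k) = trans (cong ((m * n) *_) (*-^-distrib m n k))
  ([m*n]*[o*p]≡[m*o]*[n*p] m n (m ^ k) (n ^ k))

1≤n^n : ∀ n → 1 ≤ n ^ n
1≤n^n zero    = ≤-refl
1≤n^n (suc n) = m^n>0 (suc n) (suc n)

-- Split (x + y)^(x + y) as ((x + y)²)^x (x + y)^(y - x) and use
-- (x + y)² ≥ 4xy on the first factor, x + y ≥ y on the second.
two-point-ordered : ∀ x k → let y = x + k in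
  2 ^ (x + y) * (x ^ x * y ^ y) ≤ 2 ^ k * (x + y) ^ (x + y)
two-point-ordered x k = begin
  2 ^ (x + (x + k)) * (x ^ x * y ^ (x + k))
    ≡⟨ cong₂ _*_ split₂ (cong (x ^ x *_) (^-distribˡ-+-* y x k)) ⟩
  ((4 ^ x) * 2 ^ k) * (x ^ x * (y ^ x * y ^ k))
    ≡⟨ rearrange (4 ^ x) (2 ^ k) (x ^ x) (y ^ x) (y ^ k) ⟩
  2 ^ k * ((4 ^ x * (x ^ x * y ^ x)) * y ^ k)
    ≡⟨ cong (λ s → 2 ^ k * (s * y ^ k)) (sym (trans (*-^-distrib 4 (x * y) x)
         (cong (4 ^ x *_) (*-^-distrib x y x)))) ⟩
  2 ^ k * ((4 * (x * y)) ^ x * y ^ k)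
    ≤⟨ *-monoʳ-≤ (2 ^ k) (*-mono-≤ (^-monoˡ-≤ x am-gm) (^-monoˡ-≤ k (m≤n+m y x))) ⟩
  2 ^ k * (((x + y) * (x + y)) ^ x * (x + y) ^ k)
    ≡⟨ cong (2 ^ k *_) (cong (_* (x + y) ^ k) (*-^-distrib (x + y) (x + y) x)) ⟩
  2 ^ k * (((x + y) ^ x * (x + y) ^ x) * (x + y) ^ k)
    ≡⟨ cong (2 ^ k *_) (trans (*-assoc ((x + y) ^ x) _ _)
         (trans (cong ((x + y) ^ x *_) (sym (^-distribˡ-+-* (x + y) x k)))
                (sym (^-distribˡ-+-* (x + y) x y)))) ⟩
  2 ^ k * (x + y) ^ (x + y) ∎
  where
  open ≤-Reasoning
  y = x + k
  split₂ : 2 ^ (x + (x + k)) ≡ 4 ^ x * 2 ^ k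
  split₂ = trans (cong (2 ^_) (sym (+-assoc x x k))) (trans (^-distribˡ-+-* 2 (x + x) k)
    (cong (_* 2 ^ k) (trans (^-distribˡ-+-* 2 x x) (sym (*-^-distrib 2 2 x)))))
  rearrange : ∀ a b c e g → (a * b) * (c * (e * g)) ≡ b * ((a * (c * e)) * g)
  rearrange = solve-∀
  square : ∀ x k → (x + (x + k)) * (x + (x + k)) ≡ 4 * (x * (x + k)) + k * k
  square = solve-∀
  am-gm : 4 * (x * y) ≤ (x + y) * (x + y)
  am-gm = ≤-trans (m≤m+n _ (k * k)) (≤-reflexive (sym (square x k)))

two-point-≤ : ∀ {x y δ} → x ≤ y → y ≤ x + δ →
  2 ^ (x + y) * (x ^ x * y ^ y) ≤ 2 ^ δ * (x + y) ^ (x + y)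
two-point-≤ {x} {y} {δ} x≤y y≤x+δ with m≤n⇒∃[o]m+o≡n x≤y
... | k , refl = ≤-trans (two-point-ordered x k)
  (*-monoˡ-≤ ((x + (x + k)) ^ (x + (x + k))) (^-monoʳ-≤ 2 (+-cancelˡ-≤ x k δ y≤x+δ)))

-- In logarithms to base 2 this is the entropy inequality x log x + y log y + (x + y) ≤ (x + y) log
-- (x + y) + δ for δ ≥ |x - y|. It is symmetric because either half of the cube may hold the larger
-- part.
two-point : ∀ {x y δ} → x ≤ y + δ → y ≤ x + δ →
  2 ^ (x + y) * (x ^ x * y ^ y) ≤ 2 ^ δ * (x + y) ^ (x + y)
two-point {x} {y} {δ} x≤ y≤ with ≤-total x y
... | inj₁ x≤y = two-point-≤ x≤y y≤
... | inj₂ y≤x = subst₂ _≤_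
  (cong₂ _*_ (cong (2 ^_) (+-comm y x)) (*-comm (y ^ y) (x ^ x)))
  (cong (λ s → 2 ^ δ * s ^ s) (+-comm y x))
  (two-point-≤ y≤x x≤)

cut : ∀ {d} → (a ā : Point d → ℕ) → ℕ
cut {d} a ā = ∑[ u ← cube d ] ∑[ i ← allFin d ] (a u * ā (flip i u))

cut-suc : ∀ {d} (a ā : Point (suc d) → ℕ) →
  cut a ā ≡ (∑[ u ← cube d ] (a (false ∷ u) * ā (true ∷ u)) +
             ∑[ u ← cube d ] (a (true ∷ u) * ā (false ∷ u))) +
            (cut (a ∘ (false ∷_)) (ā ∘ (false ∷_)) + cut (a ∘ (true ∷_)) (ā ∘ (true ∷_)))
cut-suc {d} a ā = trans (∑-cube d _) (trans (cong₂ _+_ (half false) (half true))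
  (rearrange (∑[ u ← cube d ] (a (false ∷ u) * ā (true ∷ u)))
             (cut (a ∘ (false ∷_)) (ā ∘ (false ∷_)))
             (∑[ u ← cube d ] (a (true ∷ u) * ā (false ∷ u))) _))
  where
  half : ∀ x → ∑[ u ← cube d ] ∑[ i ← allFin (suc d) ] (a (x ∷ u) * ā (flip i (x ∷ u)))
             ≡ ∑[ u ← cube d ] (a (x ∷ u) * ā (not x ∷ u)) + cut (a ∘ (x ∷_)) (ā ∘ (x ∷_))
  half x = trans (∑-cong (cube d) (λ u → ∑-allFin d _)) (∑-+ (cube d) _ _)
  rearrange : ∀ p q r s → (p + q) + (r + s) ≡ (p + r) + (q + s)
  rearrange = solve-∀

-- Induction on the dimension, splitting the set into halves of sizes `x` and `y` by the first
-- coordinate. At least |x - y| cut edges run between the halves, which is the loss that `two-point`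
-- allows. Subcubes attain equality.
edge-isoperimetry : ∀ {d} (a ā : Point d → ℕ) → (∀ u → a u + ā u ≡ 1) →
  let n = ∑ (cube d) a in 2 ^ (d * n) ≤ 2 ^ cut a ā * n ^ n
edge-isoperimetry {zero}  a ā a+ā≡1 = ≤-trans (1≤n^n (∑ (cube 0) a))
  (≤-reflexive (sym (+-identityʳ _)))
edge-isoperimetry {suc d} a ā a+ā≡1 = begin
  2 ^ (suc d * ∑ (cube (suc d)) a)
    ≡⟨ cong (λ n → 2 ^ (suc d * n)) (∑-cube d a) ⟩
  2 ^ (suc d * (x + y))
    ≡⟨ trans (cong (2 ^_) (cong ((x + y) +_) (*-distribˡ-+ d x y)))
         (trans (^-distribˡ-+-* 2 (x + y) _) (cong (2 ^ (x + y) *_) (^-distribˡ-+-* 2 (d * x) (d * y)))) ⟩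
  2 ^ (x + y) * (2 ^ (d * x) * 2 ^ (d * y))
    ≤⟨ *-monoʳ-≤ (2 ^ (x + y)) (*-mono-≤
         (edge-isoperimetry (a ∘ (false ∷_)) (ā ∘ (false ∷_)) (a+ā≡1 ∘ (false ∷_)))
         (edge-isoperimetry (a ∘ (true ∷_)) (ā ∘ (true ∷_)) (a+ā≡1 ∘ (true ∷_)))) ⟩
  2 ^ (x + y) * ((2 ^ e₀ * x ^ x) * (2 ^ e₁ * y ^ y))
    ≡⟨ rearrange (2 ^ (x + y)) (2 ^ e₀) (x ^ x) (2 ^ e₁) (y ^ y) ⟩
  (2 ^ (x + y) * (x ^ x * y ^ y)) * (2 ^ e₀ * 2 ^ e₁)
    ≤⟨ *-monoˡ-≤ (2 ^ e₀ * 2 ^ e₁) (two-point {x} {y} {δ₀ + δ₁} x≤ y≤) ⟩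
  (2 ^ (δ₀ + δ₁) * (x + y) ^ (x + y)) * (2 ^ e₀ * 2 ^ e₁)
    ≡⟨ trans (swap-last (2 ^ (δ₀ + δ₁)) ((x + y) ^ (x + y)) (2 ^ e₀ * 2 ^ e₁))
         (cong (_* (x + y) ^ (x + y)) (trans (cong (2 ^ (δ₀ + δ₁) *_) (sym (^-distribˡ-+-* 2 e₀ e₁)))
                                              (sym (^-distribˡ-+-* 2 (δ₀ + δ₁) (e₀ + e₁))))) ⟩
  2 ^ ((δ₀ + δ₁) + (e₀ + e₁)) * (x + y) ^ (x + y)
    ≡⟨ cong₂ (λ c n → 2 ^ c * n ^ n) (cut-suc a ā) (∑-cube d a) ⟨
  2 ^ cut a ā * ∑ (cube (suc d)) a ^ ∑ (cube (suc d)) a ∎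
  where
  open ≤-Reasoning
  x y e₀ e₁ δ₀ δ₁ : ℕ
  x = ∑[ u ← cube d ] a (false ∷ u)
  y = ∑[ u ← cube d ] a (true ∷ u)
  e₀ = cut (a ∘ (false ∷_)) (ā ∘ (false ∷_))
  e₁ = cut (a ∘ (true ∷_)) (ā ∘ (true ∷_))
  δ₀ = ∑[ u ← cube d ] (a (false ∷ u) * ā (true ∷ u))
  δ₁ = ∑[ u ← cube d ] (a (true ∷ u) * ā (false ∷ u))
  -- A member of one half either has its twin in the set or sends a cut edge to it.
  step : ∀ p p̄ q q̄ → p + p̄ ≡ 1 → q + q̄ ≡ 1 → p ≤ q + p * q̄
  step p p̄ zero q̄ _ refl rewrite *-identityʳ p = ≤-refl
  step zero p̄ (suc q) q̄ _ _ = z≤n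
  step (suc zero) p̄ (suc q) q̄ _ _ = s≤s z≤n
  step (suc (suc p)) p̄ (suc q) q̄ () _
  x≤ : x ≤ y + (δ₀ + δ₁)
  x≤ = ≤-trans (∑-mono (cube d) (λ u → step _ _ _ _ (a+ā≡1 (false ∷ u)) (a+ā≡1 (true ∷ u))))
    (≤-trans (≤-reflexive (∑-+ (cube d) _ _)) (+-monoʳ-≤ y (m≤m+n δ₀ δ₁)))
  y≤ : y ≤ x + (δ₀ + δ₁)
  y≤ = ≤-trans (∑-mono (cube d) (λ u → step _ _ _ _ (a+ā≡1 (true ∷ u)) (a+ā≡1 (false ∷ u))))
    (≤-trans (≤-reflexive (∑-+ (cube d) _ _)) (+-monoʳ-≤ x (m≤n+m δ₁ δ₀)))
  rearrange : ∀ a b c e g → a * ((b * c) * (e * g)) ≡ (a * (c * g)) * (b * e)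
  rearrange = solve-∀
  swap-last : ∀ a b c → (a * b) * c ≡ (a * c) * b
  swap-last = solve-∀

-- Expansion after deleting sparse points

deg : ∀ {d} → (Point d → ℕ) → Point d → ℕ
deg {d} f u = ∑[ i ← allFin d ] f (flip i u)

term≤deg : ∀ {d} (f : Point d → ℕ) u i → f (flip i u) ≤ deg f u
term≤deg f u i = ∑-term-∈ (λ i → f (flip i u)) (∈-allFin i)

deg-+ : ∀ {d} (f g : Point d → ℕ) u → deg (λ v → f v + g v) u ≡ deg f u + deg g u
deg-+ {d} f g u = ∑-+ (allFin d) _ _

cut-deg : ∀ {d} (f g : Point d → ℕ) → cut f g ≡ ∑[ u ← cube d ] (f u * deg g u)
cut-deg {d} f g = ∑-cong (cube d) (λ u → ∑-*ˡ (allFin d) (f u) _)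

cut-+ˡ : ∀ {d} (f f′ g : Point d → ℕ) → cut (λ u → f u + f′ u) g ≡ cut f g + cut f′ g
cut-+ˡ {d} f f′ g = trans
  (∑-cong (cube d) (λ u → trans
    (∑-cong (allFin d) (λ i → *-distribʳ-+ (g (flip i u)) (f u) (f′ u)))
    (∑-+ (allFin d) _ _)))
  (∑-+ (cube d) _ _)

-- Each flip is an involution of the cube, so reindexing by it reverses the edges in that direction.
-- All later double counting between points and their neighbours rests on this.
cut-sym : ∀ {d} (f g : Point d → ℕ) → cut f g ≡ cut g f
cut-sym {d} f g = begin
  ∑[ u ← cube d ] ∑[ i ← allFin d ] (f u * g (flip i u))
    ≡⟨ ∑-swap (cube d) (allFin d) _ ⟩
  ∑[ i ← allFin d ] ∑[ u ← cube d ] (f u * g (flip i u))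
    ≡⟨ ∑-cong (allFin d) (λ i → ∑-cong (cube d) (λ u → trans (*-comm (f u) _)
         (cong (λ v → g (flip i u) * f v) (sym (flip-involutive i u))))) ⟩
  ∑[ i ← allFin d ] ∑[ u ← cube d ] (g (flip i u) * f (flip i (flip i u)))
    ≡⟨ ∑-cong (allFin d) (λ i → ∑-flip i (λ u → g u * f (flip i u))) ⟩
  ∑[ i ← allFin d ] ∑[ u ← cube d ] (g u * f (flip i u))
    ≡⟨ ∑-swap (allFin d) (cube d) _ ⟩
  ∑[ u ← cube d ] ∑[ i ← allFin d ] (g u * f (flip i u)) ∎
  where open ≡-Reasoning

cut-+ʳ : ∀ {d} (f g g′ : Point d → ℕ) → cut f (λ u → g u + g′ u) ≡ cut f g + cut f g′
cut-+ʳ f g g′ = trans (cut-sym f (λ u → g u + g′ u))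
  (trans (cut-+ˡ g g′ f) (cong₂ _+_ (cut-sym g f) (cut-sym g′ f)))

isZero isPos : ℕ → ℕ
isZero zero    = 1
isZero (suc _) = 0
isPos zero     = 0
isPos (suc _)  = 1

isZero+isPos : ∀ n → isZero n + isPos n ≡ 1
isZero+isPos zero    = refl
isZero+isPos (suc n) = refl

m*isZero[n]*n≡0 : ∀ m n → m * isZero n * n ≡ 0
m*isZero[n]*n≡0 m zero    = *-zeroʳ (m * 1)
m*isZero[n]*n≡0 m (suc n) = cong (_* suc n) (*-zeroʳ m)

m*isZero≤m : ∀ m n → m * isZero n ≤ m
m*isZero≤m m zero    = ≤-reflexive (*-identityʳ m)
m*isZero≤m m (suc n) = ≤-trans (≤-reflexive (*-zeroʳ m)) z≤n

m*isPos≤m : ∀ m n → m * isPos n ≤ m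
m*isPos≤m m zero    = ≤-trans (≤-reflexive (*-zeroʳ m)) z≤n
m*isPos≤m m (suc n) = ≤-reflexive (*-identityʳ m)

-- Squaring N^(n+k) ≤ 2^e (n+k)^(n+k) and using (n+k)² ≤ N n trades the
-- larger base n + k for n, at the price of doubling e.
shrink-base : ∀ N n k e .{{_ : NonZero N}} → (n + k) * (n + k) ≤ N * n → n ≤ N →
  N ^ (n + k) ≤ 2 ^ e * (n + k) ^ (n + k) → N ^ n ≤ 2 ^ (2 * e) * n ^ n
shrink-base N n k e square≤ n≤N N^a≤ =
  *-cancelʳ-≤ (N ^ n) _ (N ^ k) {{m^n≢0 N k}} (begin
    N ^ n * N ^ k
      ≡⟨ ^-distribˡ-+-* N n k ⟨
    N ^ a
      ≤⟨ *-cancelʳ-≤ (N ^ a) _ (N ^ a) {{m^n≢0 N a}} squared ⟩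
    2 ^ (2 * e) * n ^ a
      ≡⟨ cong (2 ^ (2 * e) *_) (^-distribˡ-+-* n n k) ⟩
    2 ^ (2 * e) * (n ^ n * n ^ k)
      ≤⟨ *-monoʳ-≤ (2 ^ (2 * e)) (*-monoʳ-≤ (n ^ n) (^-monoˡ-≤ k n≤N)) ⟩
    2 ^ (2 * e) * (n ^ n * N ^ k)
      ≡⟨ *-assoc (2 ^ (2 * e)) _ _ ⟨
    2 ^ (2 * e) * n ^ n * N ^ k ∎)
  where
  open ≤-Reasoning
  a = n + k
  2^e*2^e : 2 ^ e * 2 ^ e ≡ 2 ^ (2 * e)
  2^e*2^e = trans (sym (^-distribˡ-+-* 2 e e)) (cong (λ s → 2 ^ (e + s)) (sym (+-identityʳ e)))
  rearrange : ∀ p q r → p * (q * r) ≡ (p * r) * q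
  rearrange = solve-∀
  squared : N ^ a * N ^ a ≤ 2 ^ (2 * e) * n ^ a * N ^ a
  squared = begin
    N ^ a * N ^ a
      ≤⟨ *-mono-≤ N^a≤ N^a≤ ⟩
    (2 ^ e * a ^ a) * (2 ^ e * a ^ a)
      ≡⟨ [m*n]*[o*p]≡[m*o]*[n*p] (2 ^ e) (a ^ a) (2 ^ e) (a ^ a) ⟩
    (2 ^ e * 2 ^ e) * (a ^ a * a ^ a)
      ≡⟨ cong₂ _*_ 2^e*2^e (sym (*-^-distrib a a a)) ⟩
    2 ^ (2 * e) * (a * a) ^ a
      ≤⟨ *-monoʳ-≤ (2 ^ (2 * e)) (^-monoˡ-≤ a square≤) ⟩
    2 ^ (2 * e) * (N * n) ^ a
      ≡⟨ cong (2 ^ (2 * e) *_) (*-^-distrib N n a) ⟩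
    2 ^ (2 * e) * (N ^ a * n ^ a)
      ≡⟨ rearrange (2 ^ (2 * e)) (N ^ a) (n ^ a) ⟩
    2 ^ (2 * e) * n ^ a * N ^ a ∎

-- From k² ≤ nk/2 the square is at most n(n + 5k/2). The first summand uses up three quarters of N,
-- and 10k ≤ N is what fits the second into the remaining quarter.
square-bound : ∀ N n k → 2 * k ≤ n → 10 * k ≤ N → 4 * n ≤ 3 * N →
               (n + k) * (n + k) ≤ N * n
square-bound N n k 2k≤n 10k≤N 4n≤3N = *-cancelˡ-≤ 20 (begin
  20 * ((n + k) * (n + k))
    ≡⟨ expand n k ⟩
  5 * n * (4 * n) + 40 * (n * k) + 10 * k * (2 * k)
    ≤⟨ +-monoʳ-≤ (5 * n * (4 * n) + 40 * (n * k)) (*-monoʳ-≤ (10 * k) 2k≤n) ⟩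
  5 * n * (4 * n) + 40 * (n * k) + 10 * k * n
    ≡⟨ collect n k ⟩
  5 * n * (4 * n) + 5 * n * (10 * k)
    ≤⟨ +-mono-≤ (*-monoʳ-≤ (5 * n) 4n≤3N) (*-monoʳ-≤ (5 * n) 10k≤N) ⟩
  5 * n * (3 * N) + 5 * n * N
    ≡⟨ total N n ⟩
  20 * (N * n) ∎)
  where
  open ≤-Reasoning
  expand : ∀ n k → 20 * ((n + k) * (n + k)) ≡ 5 * n * (4 * n) + 40 * (n * k) + 10 * k * (2 * k)
  expand = solve-∀
  collect : ∀ n k → 5 * n * (4 * n) + 40 * (n * k) + 10 * k * n ≡ 5 * n * (4 * n) + 5 * n * (10 * k)
  collect = solve-∀
  total : ∀ N n → 5 * n * (3 * N) + 5 * n * N ≡ 20 * (N * n)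
  total = solve-∀

-- b, c and m are the indicators of B, of S \ B, and of the missing points {0,1}^d \ S.
module Expansion {d : ℕ} (b c m : Point d → ℕ)
  (partition : ∀ u → b u + c u + m u ≡ 1)
  (few-missing-neighbours : ∀ u → 3 * deg m u < d)
  where

  private
    instance
      d≢0 : NonZero d
      d≢0 = >-nonZero (≤-trans (s≤s z≤n) (few-missing-neighbours (replicate d false)))

  3deg≤d : ∀ u → 3 * deg m u ≤ d
  3deg≤d u = <⇒≤ (few-missing-neighbours u)

  deg-partition : ∀ u → deg b u + deg c u + deg m u ≡ d
  deg-partition u = trans (cong (_+ deg m u) (sym (deg-+ b c u)))
    (trans (sym (deg-+ (λ v → b v + c v) m u))
      (trans (∑-cong (allFin d) (λ i → partition (flip i u))) (∑-allFin-1 d)))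

  -- An absorbed point joins the side of B: on the other side its edges to B would have no clique
  -- edges to be charged to.
  absorbed exposed : Point d → ℕ
  absorbed u = m u * isZero (deg c u)
  exposed u  = m u * isPos (deg c u)

  -- At these points the clique term `deg b * deg c` vanishes, and every edge to the inner side ends
  -- in an absorbed point. Such edges are charged to squares.
  remote : Point d → ℕ
  remote u = exposed u * isZero (deg b u)

  inner outer : Point d → ℕ
  inner u = b u + absorbed u
  outer u = c u + exposed u

  inner+outer≡1 : ∀ u → inner u + outer u ≡ 1
  inner+outer≡1 u = trans (rearrange (b u) (absorbed u) (c u) (exposed u))
    (trans (cong (b u + c u +_) (trans (sym (*-distribˡ-+ (m u) _ _))
      (trans (cong (m u *_) (isZero+isPos (deg c u))) (*-identityʳ (m u)))))
    (partition u))
    where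
    rearrange : ∀ p q r s → (p + q) + (r + s) ≡ p + r + (q + s)
    rearrange = solve-∀

  absorbed≤m : ∀ u → absorbed u ≤ m u
  absorbed≤m u = m*isZero≤m (m u) (deg c u)

  m≤1 : ∀ u → m u ≤ 1
  m≤1 u = ≤-trans (m≤n+m (m u) (b u + c u)) (≤-reflexive (partition u))

  -- `clique-edges` counts paths from B through a missing midpoint to the rest of S. A pair at
  -- distance two has two common neighbours and may be counted twice, hence the form
  -- `2 * direct-edges + clique-edges ≤ 2 * e` in `expansion`.
  direct-edges clique-edges : ℕ
  direct-edges = cut b c
  clique-edges = ∑[ w ← cube d ] (m w * (deg b w * deg c w))

  -- An absorbed point has neighbours only in B and among the missing points, so at least 2d/3 of
  -- them lie in B. A point of B has at most d/3 missing neighbours. Counting the edges between the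
  -- two kinds from both ends gives the ratio 2.
  2*absorbed≤b : 2 * ∑ (cube d) absorbed ≤ ∑ (cube d) b
  2*absorbed≤b = *-cancelˡ-≤ d (begin
    d * (2 * ∑ (cube d) absorbed)
      ≡⟨ rearrange d (∑ (cube d) absorbed) ⟩
    ∑ (cube d) absorbed * (2 * d)
      ≡⟨ ∑-*ʳ (cube d) absorbed (2 * d) ⟨
    ∑[ w ← cube d ] (absorbed w * (2 * d))
      ≤⟨ ∑-mono (cube d) pointwise ⟩
    ∑[ w ← cube d ] (3 * (m w * deg b w))
      ≡⟨ ∑-*ˡ (cube d) 3 _ ⟩
    3 * ∑[ w ← cube d ] (m w * deg b w)
      ≡⟨ cong (3 *_) (trans (sym (cut-deg m b)) (trans (cut-sym m b) (cut-deg b m))) ⟩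
    3 * ∑[ u ← cube d ] (b u * deg m u)
      ≡⟨ ∑-*ˡ (cube d) 3 _ ⟨
    ∑[ u ← cube d ] (3 * (b u * deg m u))
      ≤⟨ ∑-mono (cube d) (λ u → ≤-trans (≤-reflexive (rearrange′ (b u) (deg m u)))
                                         (*-monoʳ-≤ (b u) (3deg≤d u))) ⟩
    ∑[ u ← cube d ] (b u * d)
      ≡⟨ ∑-*ʳ (cube d) b d ⟩
    ∑ (cube d) b * d
      ≡⟨ *-comm _ d ⟩
    d * ∑ (cube d) b ∎)
    where
    open ≤-Reasoning
    rearrange : ∀ p q → p * (2 * q) ≡ q * (2 * p)
    rearrange = solve-∀
    rearrange′ : ∀ p q → 3 * (p * q) ≡ p * (3 * q)
    rearrange′ = solve-∀
    bound : ∀ β μ δ → β + 0 + μ ≡ δ → 3 * μ ≤ δ → 2 * δ ≤ 3 * β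
    bound β μ δ refl 3μ≤ = +-cancelʳ-≤ (β + 0 + μ) _ _ (begin
      2 * (β + 0 + μ) + (β + 0 + μ) ≡⟨ expand β μ ⟩
      3 * β + 3 * μ                 ≤⟨ +-monoʳ-≤ (3 * β) 3μ≤ ⟩
      3 * β + (β + 0 + μ)           ∎)
      where
      expand : ∀ β μ → 2 * (β + 0 + μ) + (β + 0 + μ) ≡ 3 * β + 3 * μ
      expand = solve-∀
    pointwise : ∀ w → absorbed w * (2 * d) ≤ 3 * (m w * deg b w)
    pointwise w with deg c w | deg-partition w
    ... | suc _ | _ = ≤-trans (≤-reflexive (cong (_* (2 * d)) (*-zeroʳ (m w)))) z≤n
    ... | zero  | eq = begin
      m w * 1 * (2 * d)    ≡⟨ cong (_* (2 * d)) (*-identityʳ (m w)) ⟩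
      m w * (2 * d)        ≤⟨ *-monoʳ-≤ (m w) (bound (deg b w) (deg m w) d eq (3deg≤d w)) ⟩
      m w * (3 * deg b w)  ≡⟨ rearrange′ (m w) (deg b w) ⟨
      3 * (m w * deg b w)  ∎

  -- Through each pair of an absorbed and an adjacent remote point pass at
  -- least d/3 squares whose opposite side joins B to its complement.
  squares : ∀ w w′ → deg b w ≡ 0 → deg c w′ ≡ 0 →
            d ≤ 3 * ∑[ i ← allFin d ] (c (flip i w) * b (flip i w′))
  squares w w′ bw≡0 cw′≡0 = +-cancelʳ-≤ (2 * d) _ _ (begin
    d + 2 * d
      ≡⟨ cong (3 *_) (∑-allFin-1 d) ⟨
    3 * ∑[ _ ← allFin d ] 1
      ≤⟨ *-monoʳ-≤ 3 (∑-mono (allFin d) pointwise) ⟩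
    3 * ∑[ i ← allFin d ] (c (flip i w) * b (flip i w′) + (m (flip i w) + m (flip i w′)))
      ≡⟨ cong (3 *_) (trans (∑-+ (allFin d) _ _) (cong (s +_) (∑-+ (allFin d) _ _))) ⟩
    3 * (s + (deg m w + deg m w′))
      ≡⟨ expand s (deg m w) (deg m w′) ⟩
    3 * s + (3 * deg m w + 3 * deg m w′)
      ≤⟨ +-monoʳ-≤ (3 * s) (+-mono-≤ (3deg≤d w) (3deg≤d w′)) ⟩
    3 * s + (d + d)
      ≡⟨ cong (λ t → 3 * s + (d + t)) (+-identityʳ d) ⟨
    3 * s + 2 * d ∎)
    where
    open ≤-Reasoning
    s = ∑[ i ← allFin d ] (c (flip i w) * b (flip i w′))
    expand : ∀ p q r → 3 * (p + (q + r)) ≡ 3 * p + (3 * q + 3 * r)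
    expand = solve-∀
    arith : ∀ β γ μ β′ γ′ μ′ → β + γ + μ ≡ 1 → β′ + γ′ + μ′ ≡ 1 → β ≡ 0 → γ′ ≡ 0 →
            1 ≤ γ * β′ + (μ + μ′)
    arith _ zero _ _ _ μ′ refl _ refl refl = s≤s z≤n
    arith _ (suc γ) μ (suc β′) _ _ _ _ refl refl = s≤s z≤n
    arith _ (suc γ) μ zero _ _ _ refl refl refl =
      ≤-trans (m≤n+m 1 μ) (m≤n+m (μ + 1) (γ * 0))
    pointwise : ∀ i → 1 ≤ c (flip i w) * b (flip i w′) + (m (flip i w) + m (flip i w′))
    pointwise i = arith _ _ _ _ _ _ (partition (flip i w)) (partition (flip i w′))
      (n≤0⇒n≡0 (≤-trans (term≤deg b w i) (≤-reflexive bw≡0)))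
      (n≤0⇒n≡0 (≤-trans (term≤deg c w′ i) (≤-reflexive cw′≡0)))

  -- Count pairs of a remote-absorbed edge and a parallel direct edge at distance one. By `squares`
  -- each edge of the first kind is in at least d/3 pairs. A direct edge is in at most d/3, since
  -- the direction of the shift must lead from its end in `c` to a missing point.
  remote-absorbed≤direct : cut remote absorbed ≤ direct-edges
  remote-absorbed≤direct = *-cancelʳ-≤ _ _ d (begin
    cut remote absorbed * d
      ≡⟨ trans (sym (∑-*ʳ (cube d) _ d)) (∑-cong (cube d) (λ w → sym (∑-*ʳ (allFin d) _ d))) ⟩
    ∑[ w ← cube d ] ∑[ j ← allFin d ] (remote w * absorbed (flip j w) * d)
      ≤⟨ ∑-mono (cube d) (λ w → ∑-mono (allFin d) (λ j → lower w (flip j w))) ⟩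
    ∑[ w ← cube d ] ∑[ j ← allFin d ] (3 * ∑[ i ← allFin d ] (m w * (c (flip i w) * b (flip i (flip j w)))))
      ≡⟨ trans (∑-cong (cube d) (λ w → ∑-*ˡ (allFin d) 3 _)) (∑-*ˡ (cube d) 3 _) ⟩
    3 * ∑[ w ← cube d ] ∑[ j ← allFin d ] ∑[ i ← allFin d ] (m w * (c (flip i w) * b (flip i (flip j w))))
      -- The substitution w = `flip i u` slides along direction `i` to the opposite side of the
      -- square, so the sum is now indexed by the direct edge.
      ≡⟨ cong (3 *_) (trans (pull _)
           (trans (∑-cong (allFin d) (λ j → ∑-cong (allFin d) (reindex j))) (sym (pull _)))) ⟩
    3 * ∑[ u ← cube d ] ∑[ j ← allFin d ] ∑[ i ← allFin d ] (m (flip i u) * (c u * b (flip j u)))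
      ≡⟨ trans (sym (∑-*ˡ (cube d) 3 _)) (∑-cong (cube d) (λ u → sym (∑-*ˡ (allFin d) 3 _))) ⟩
    ∑[ u ← cube d ] ∑[ j ← allFin d ] (3 * ∑[ i ← allFin d ] (m (flip i u) * (c u * b (flip j u))))
      ≤⟨ ∑-mono (cube d) (λ u → ∑-mono (allFin d) (λ j → upper u (c u * b (flip j u)))) ⟩
    ∑[ u ← cube d ] ∑[ j ← allFin d ] (c u * b (flip j u) * d)
      ≡⟨ trans (∑-cong (cube d) (λ u → ∑-*ʳ (allFin d) _ d)) (∑-*ʳ (cube d) _ d) ⟩
    cut c b * d
      ≡⟨ cong (_* d) (cut-sym c b) ⟩
    cut b c * d ∎)
    where
    open ≤-Reasoning
    pull : (f : Point d → Fin d → Fin d → ℕ) →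
           ∑[ w ← cube d ] ∑[ j ← allFin d ] ∑[ i ← allFin d ] f w j i ≡
           ∑[ j ← allFin d ] ∑[ i ← allFin d ] ∑[ w ← cube d ] f w j i
    pull f = trans (∑-swap (cube d) (allFin d) _)
      (∑-cong (allFin d) (λ j → ∑-swap (cube d) (allFin d) _))
    reindex : ∀ j i →
      ∑[ w ← cube d ] (m w * (c (flip i w) * b (flip i (flip j w)))) ≡
      ∑[ u ← cube d ] (m (flip i u) * (c u * b (flip j u)))
    reindex j i = trans (sym (∑-flip i _)) (∑-cong (cube d) (λ u →
      cong₂ (λ x y → m (flip i u) * (c x * b y)) (flip-involutive i u)
        (trans (cong (flip i) (flip-comm j i u)) (flip-involutive i (flip j u)))))
    upper : ∀ u e → 3 * ∑[ i ← allFin d ] (m (flip i u) * e) ≤ e * d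
    upper u e = begin
      3 * ∑[ i ← allFin d ] (m (flip i u) * e) ≡⟨ cong (3 *_) (∑-*ʳ (allFin d) _ e) ⟩
      3 * (deg m u * e)                        ≡⟨ rearrange (deg m u) e ⟩
      e * (3 * deg m u)                        ≤⟨ *-monoʳ-≤ e (3deg≤d u) ⟩
      e * d                                    ∎
      where
      rearrange : ∀ p q → 3 * (p * q) ≡ q * (3 * p)
      rearrange = solve-∀
    lower : ∀ w w′ → remote w * absorbed w′ * d ≤
            3 * ∑[ i ← allFin d ] (m w * (c (flip i w) * b (flip i w′)))
    lower w w′ with deg b w in bw | deg c w′ in cw′
    ... | suc _ | γ = ≤-trans
      (≤-reflexive (cong (λ z → z * (m w′ * isZero γ) * d) (*-zeroʳ (exposed w)))) z≤n
    ... | zero  | suc _ = ≤-trans (≤-reflexive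
      (cong (_* d) (trans (cong (exposed w * 1 *_) (*-zeroʳ (m w′))) (*-zeroʳ (exposed w * 1))))) z≤n
    ... | zero  | zero = begin
      exposed w * 1 * (m w′ * 1) * d
        ≤⟨ *-monoˡ-≤ d (*-mono-≤ (≤-trans (≤-reflexive (*-identityʳ (exposed w))) (m*isPos≤m (m w) (deg c w)))
                                 (≤-trans (≤-reflexive (*-identityʳ (m w′))) (m≤1 w′))) ⟩
      m w * 1 * d
        ≡⟨ cong (_* d) (*-identityʳ (m w)) ⟩
      m w * d
        ≤⟨ *-monoʳ-≤ (m w) (squares w w′ bw cw′) ⟩
      m w * (3 * ∑[ i ← allFin d ] (c (flip i w) * b (flip i w′)))
        ≡⟨ rearrange (m w) (∑[ i ← allFin d ] (c (flip i w) * b (flip i w′))) ⟩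
      3 * (m w * ∑[ i ← allFin d ] (c (flip i w) * b (flip i w′)))
        ≡⟨ cong (3 *_) (∑-*ˡ (allFin d) (m w) _) ⟨
      3 * ∑[ i ← allFin d ] (m w * (c (flip i w) * b (flip i w′))) ∎
      where
      rearrange : ∀ p q → p * (3 * q) ≡ 3 * (p * q)
      rearrange = solve-∀

  -- Let β, γ, μ be the numbers of neighbours in B, in the rest of S and missing. If β and γ are
  -- positive, then β ≤ βγ, and the degree bound gives 2μ ≤ β + γ - 1 ≤ βγ, which covers the
  -- absorbed neighbours. If β = 0, the `remote` term is the whole left side.
  exposed-charge : ∀ w → exposed w * (deg b w + deg absorbed w) ≤
                   2 * (m w * (deg b w * deg c w)) + remote w * deg absorbed w
  exposed-charge w = charge (deg b w) (deg c w) (deg absorbed w) (deg m w) (m w)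
    (deg-partition w) (few-missing-neighbours w) (∑-mono (allFin d) (λ i → absorbed≤m (flip i w)))
    where
    open ≤-Reasoning
    charge : ∀ β γ n μ p → β + γ + μ ≡ d → 3 * μ < d → n ≤ μ →
             p * isPos γ * (β + n) ≤ 2 * (p * (β * γ)) + p * isPos γ * isZero β * n
    charge β zero n μ p _ _ _ = ≤-trans (≤-reflexive (cong (_* (β + n)) (*-zeroʳ p))) z≤n
    charge zero (suc γ) n μ p _ _ _ = ≤-trans
      (≤-reflexive (cong (_* n) (sym (*-identityʳ (p * 1)))))
      (m≤n+m _ (2 * (p * 0)))
    charge β@(suc β′) γ@(suc γ′) n μ p eq 3μ<d n≤μ = begin
      p * 1 * (β + n)       ≡⟨ cong (_* (β + n)) (*-identityʳ p) ⟩
      p * (β + n)           ≤⟨ *-monoʳ-≤ p (+-mono-≤ (m≤m*n β γ) (≤-trans n≤μ μ≤βγ)) ⟩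
      p * (β * γ + β * γ)   ≡⟨ rearrange p (β * γ) ⟩
      2 * (p * (β * γ))     ≤⟨ m≤m+n _ _ ⟩
      2 * (p * (β * γ)) + p * 1 * 0 * n ∎
      where
      rearrange : ∀ p q → p * (q + q) ≡ 2 * (p * q)
      rearrange = solve-∀
      lhs : ∀ μ → suc μ + (μ + μ) ≡ suc (3 * μ)
      lhs = solve-∀
      product : ∀ β′ γ′ → suc (β′ + γ′) + β′ * γ′ ≡ suc β′ * suc γ′
      product = solve-∀
      assoc : ∀ β′ γ′ μ → suc β′ + suc γ′ + μ ≡ suc (suc (β′ + γ′)) + μ
      assoc = solve-∀
      2μ< : suc (μ + μ) ≤ suc (suc (β′ + γ′))
      2μ< = +-cancelʳ-≤ μ _ _ (begin
        suc (μ + μ) + μ           ≡⟨ trans (+-comm (suc (μ + μ)) μ) (trans (+-suc μ (μ + μ)) (lhs μ)) ⟩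
        suc (3 * μ)               ≤⟨ 3μ<d ⟩
        d                         ≡⟨ sym eq ⟩
        β + γ + μ                 ≡⟨ assoc β′ γ′ μ ⟩
        suc (suc (β′ + γ′)) + μ   ∎)
      μ≤βγ : μ ≤ β * γ
      μ≤βγ = begin
        μ                         ≤⟨ m≤m+n μ μ ⟩
        μ + μ                     ≤⟨ s≤s⁻¹ 2μ< ⟩
        suc (β′ + γ′)             ≤⟨ m≤m+n _ (β′ * γ′) ⟩
        suc (β′ + γ′) + β′ * γ′   ≡⟨ product β′ γ′ ⟩
        β * γ                     ∎

  -- Of the four pieces of the cut, the one from `absorbed` to `c` is empty by construction. The two
  -- pieces ending in exposed points are summed from the exposed end, where `exposed-charge` applies
  -- pointwise.
  cut-inner-outer : cut inner outer ≤ 2 * direct-edges + 2 * clique-edges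
  cut-inner-outer = begin
    cut inner outer
      ≡⟨ trans (cut-+ˡ b absorbed outer) (cong₂ _+_ (cut-+ʳ b c exposed) (cut-+ʳ absorbed c exposed)) ⟩
    (direct-edges + cut b exposed) + (cut absorbed c + cut absorbed exposed)
      ≡⟨ cong (λ z → (direct-edges + cut b exposed) + (z + cut absorbed exposed)) absorbed-c ⟩
    (direct-edges + cut b exposed) + cut absorbed exposed
      ≡⟨ trans (+-assoc direct-edges _ _) (cong (direct-edges +_)
           (trans (sym (cut-+ˡ b absorbed exposed)) (trans (cut-sym inner exposed) (cut-deg exposed inner)))) ⟩
    direct-edges + ∑[ w ← cube d ] (exposed w * deg inner w)
      ≤⟨ +-monoʳ-≤ direct-edges (∑-mono (cube d) (λ w → ≤-trans
           (≤-reflexive (cong (exposed w *_) (deg-+ b absorbed w))) (exposed-charge w))) ⟩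
    direct-edges + ∑[ w ← cube d ] (2 * (m w * (deg b w * deg c w)) + remote w * deg absorbed w)
      ≡⟨ cong (direct-edges +_) (trans (∑-+ (cube d) _ _)
           (cong₂ _+_ (∑-*ˡ (cube d) 2 _) (sym (cut-deg remote absorbed)))) ⟩
    direct-edges + (2 * clique-edges + cut remote absorbed)
      ≤⟨ +-monoʳ-≤ direct-edges (+-monoʳ-≤ (2 * clique-edges) remote-absorbed≤direct) ⟩
    direct-edges + (2 * clique-edges + direct-edges)
      ≡⟨ rearrange direct-edges clique-edges ⟩
    2 * direct-edges + 2 * clique-edges ∎
    where
    open ≤-Reasoning
    rearrange : ∀ p q → p + (2 * q + p) ≡ 2 * p + 2 * q
    rearrange = solve-∀
    absorbed-c : cut absorbed c ≡ 0
    absorbed-c = trans (cut-deg absorbed c)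
      (trans (∑-cong (cube d) (λ w → m*isZero[n]*n≡0 (m w) (deg c w))) (∑-0 (cube d)))

  expansion : 10 * ∑ (cube d) m ≤ 2 ^ d → 4 * ∑ (cube d) b ≤ 3 * 2 ^ d →
    ∀ e → 2 * direct-edges + clique-edges ≤ 2 * e →
    2 ^ (d * ∑ (cube d) b) ≤ 2 ^ (8 * e) * ∑ (cube d) b ^ ∑ (cube d) b
  expansion 10m≤N 4n≤3N e enough = subst₂ _≤_
    (^-*-assoc 2 d n) (cong (λ s → 2 ^ s * n ^ n) (sym (*-assoc 2 4 e)))
    (shrink-base N n k (4 * e) {{m^n≢0 2 d}} (square-bound N n k 2*absorbed≤b 10k≤N 4n≤3N) n≤N (begin
      N ^ (n + k)
        ≡⟨ ^-*-assoc 2 d (n + k) ⟩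
      2 ^ (d * (n + k))
        ≡⟨ cong (λ s → 2 ^ (d * s)) (∑-+ (cube d) b absorbed) ⟨
      2 ^ (d * ∑ (cube d) inner)
        ≤⟨ edge-isoperimetry inner outer inner+outer≡1 ⟩
      2 ^ cut inner outer * ∑ (cube d) inner ^ ∑ (cube d) inner
        ≤⟨ *-monoˡ-≤ _ (^-monoʳ-≤ 2 cut≤4e) ⟩
      2 ^ (4 * e) * ∑ (cube d) inner ^ ∑ (cube d) inner
        ≡⟨ cong (λ s → 2 ^ (4 * e) * s ^ s) (∑-+ (cube d) b absorbed) ⟩
      2 ^ (4 * e) * (n + k) ^ (n + k) ∎))
    where
    open ≤-Reasoning
    N n k : ℕ
    N = 2 ^ d
    n = ∑ (cube d) b
    k = ∑ (cube d) absorbed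
    10k≤N : 10 * k ≤ N
    10k≤N = ≤-trans (*-monoʳ-≤ 10 (∑-mono (cube d) absorbed≤m)) 10m≤N
    n≤N : n ≤ N
    n≤N = *-cancelˡ-≤ 4 (≤-trans 4n≤3N (*-monoˡ-≤ N (n≤1+n 3)))
    cut≤4e : cut inner outer ≤ 4 * e
    cut≤4e = begin
      cut inner outer                           ≤⟨ cut-inner-outer ⟩
      2 * direct-edges + 2 * clique-edges       ≤⟨ m≤m+n _ (2 * direct-edges) ⟩
      2 * direct-edges + 2 * clique-edges + 2 * direct-edges
                                                ≡⟨ rearrange direct-edges clique-edges ⟩
      2 * (2 * direct-edges + clique-edges)     ≤⟨ *-monoʳ-≤ 2 enough ⟩
      2 * (2 * e)                               ≡⟨ *-assoc 2 2 e ⟨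
      4 * e                                     ∎
      where
      rearrange : ∀ p q → 2 * p + 2 * q + 2 * p ≡ 2 * (2 * p + q)
      rearrange = solve-∀

-- Edges of 0/1 polytopes

2ℚ -1ℚ : ℚ
2ℚ  = ℤ.+ 2 ℚ./ 1
-1ℚ = ℚ.- 1ℚ

0̂ : ∀ {d} → Point d
0̂ = replicate _ false

infixl 6 _⊕_
_⊕_ : ∀ {d} → Point d → Point d → Point d
_⊕_ = zipWith _xor_

⊕-self : ∀ {d} (u : Point d) → u ⊕ u ≡ 0̂
⊕-self []      = refl
⊕-self (x ∷ u) = cong₂ _∷_ (xor-same x) (⊕-self u)

⊕-0̂ : ∀ {d} (u : Point d) → u ⊕ 0̂ ≡ u
⊕-0̂ []      = refl
⊕-0̂ (x ∷ u) = cong₂ _∷_ (xor-identityʳ x) (⊕-0̂ u)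

⊕-cancel : ∀ {d} (u w : Point d) → u ⊕ (u ⊕ w) ≡ w
⊕-cancel []      []      = refl
⊕-cancel (x ∷ u) (y ∷ w) = cong₂ _∷_
  (trans (sym (xor-assoc x x y)) (cong (_xor y) (xor-same x))) (⊕-cancel u w)

⊕-flip : ∀ {d} (u : Point d) i z → u ⊕ flip i z ≡ flip i (u ⊕ z)
⊕-flip (x ∷ u) zero    (y ∷ z) = cong (_∷ (u ⊕ z)) (sym (not-distribʳ-xor x y))
⊕-flip (x ∷ u) (suc i) (y ∷ z) = cong ((x xor y) ∷_) (⊕-flip u i z)

⊕-solve : ∀ {d} {u w z : Point d} → u ⊕ w ≡ z → w ≡ u ⊕ z
⊕-solve {u = u} {w} refl = sym (⊕-cancel u w)

-- The reflection `u ⊕_` moves `u` to the origin. Functionals thus need to be designed at the origin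
-- only, and the signs carry them back to `u`.
signed : ∀ {d} → Vec ℚ d → Point d → Vec ℚ d
signed []      []          = []
signed (k ∷ κ) (true ∷ u)  = k ∷ signed κ u
signed (k ∷ κ) (false ∷ u) = ℚ.- k ∷ signed κ u

dot-signed : ∀ {d} (κ : Vec ℚ d) u w →
             dot (signed κ u) w ℚ.+ dot κ (u ⊕ w) ≡ dot (signed κ u) u
dot-signed []      []          []          = refl
dot-signed (k ∷ κ) (true ∷ u)  (true ∷ w)  =
  trans (ℚ.+-assoc k _ _) (cong (k ℚ.+_) (dot-signed κ u w))
dot-signed (k ∷ κ) (true ∷ u)  (false ∷ w) = trans
  (solve 3 (λ k x y → x :+ (k :+ y) := k :+ (x :+ y)) refl
    k (dot (signed κ u) w) (dot κ (u ⊕ w)))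
  (cong (k ℚ.+_) (dot-signed κ u w))
  where open +-*-Solver
dot-signed (k ∷ κ) (false ∷ u) (true ∷ w)  = trans
  (solve 3 (λ k x y → (:- k :+ x) :+ (k :+ y) := x :+ y) refl
    k (dot (signed κ u) w) (dot κ (u ⊕ w)))
  (dot-signed κ u w)
  where open +-*-Solver
dot-signed (k ∷ κ) (false ∷ u) (false ∷ w) = dot-signed κ u w

-- The functional signed κ u drops by dot κ (u ⊕ w) from u to w.
edge-criterion : ∀ {d} {S : List (Point d)} {u v} (κ : Vec ℚ d) →
  u ∈ S → v ∈ S → u ≢ v → dot κ (u ⊕ v) ≡ 0ℚ →
  (∀ w → w ∈ S → w ≢ u → w ≢ v → 0ℚ ℚ.< dot κ (u ⊕ w)) →
  IsEdge S u v
edge-criterion {u = u} {v} κ u∈S v∈S u≢v tie drop =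
  u∈S , v∈S , u≢v , signed κ u ,
  trans (sym (dot-signed κ u v))
    (trans (cong (dot (signed κ u) v ℚ.+_) tie) (ℚ.+-identityʳ _)) ,
  λ w w∈S w≢u w≢v → subst₂ ℚ._<_ (ℚ.+-identityʳ _) (dot-signed κ u w)
    (ℚ.+-monoʳ-< (dot (signed κ u) w) (drop w w∈S w≢u w≢v))

-- The weight 2 outweighs the least value -1 of a `seesaw`: changing any coordinate other than `i`
-- and `j` makes the drop positive.
heavy : ∀ {d} → Vec ℚ d
heavy = replicate _ 2ℚ

spike : ∀ {d} → ℚ → Fin d → Vec ℚ d
spike s zero    = s ∷ heavy
spike s (suc i) = 2ℚ ∷ spike s i

-- seesaw i j is negative only at flip i, the corner of the square that will be missing;
-- seesaw i i is a junk value.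
seesaw : ∀ {d} → Fin d → Fin d → Vec ℚ d
seesaw zero    zero    = heavy
seesaw zero    (suc j) = -1ℚ ∷ spike 1ℚ j
seesaw (suc i) zero    = 1ℚ ∷ spike -1ℚ i
seesaw (suc i) (suc j) = 2ℚ ∷ seesaw i j

dot-0̂ : ∀ {d} (κ : Vec ℚ d) → dot κ 0̂ ≡ 0ℚ
dot-0̂ []      = refl
dot-0̂ (k ∷ κ) = dot-0̂ κ

dot-spike-flip : ∀ {d} s (i : Fin d) → dot (spike s i) (flip i 0̂) ≡ s
dot-spike-flip {suc d} s zero    = trans (cong (s ℚ.+_) (dot-0̂ {d} heavy)) (ℚ.+-identityʳ s)
dot-spike-flip {suc d} s (suc i) = dot-spike-flip s i

dot-seesaw-flip : ∀ {d} (i j : Fin d) → i ≢ j → dot (seesaw i j) (flip i 0̂) ≡ -1ℚ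
dot-seesaw-flip zero    zero    i≢j = contradiction refl i≢j
dot-seesaw-flip zero    (suc j) i≢j = cong (-1ℚ ℚ.+_) (dot-0̂ (spike 1ℚ j))
dot-seesaw-flip (suc i) zero    i≢j = dot-spike-flip -1ℚ i
dot-seesaw-flip (suc i) (suc j) i≢j = dot-seesaw-flip i j (i≢j ∘ cong suc)

dot-seesaw-flip₂ : ∀ {d} (i j : Fin d) → i ≢ j → dot (seesaw i j) (flip j (flip i 0̂)) ≡ 0ℚ
dot-seesaw-flip₂ zero    zero    i≢j = contradiction refl i≢j
dot-seesaw-flip₂ zero    (suc j) i≢j = cong (-1ℚ ℚ.+_) (dot-spike-flip 1ℚ j)
dot-seesaw-flip₂ (suc i) zero    i≢j = cong (1ℚ ℚ.+_) (dot-spike-flip -1ℚ i)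
dot-seesaw-flip₂ (suc i) (suc j) i≢j = dot-seesaw-flip₂ i j (i≢j ∘ cong suc)

heavy-values : ∀ {d} (z : Point d) → z ≡ 0̂ ⊎ 2ℚ ℚ.≤ dot heavy z
heavy-values []          = inj₁ refl
heavy-values (false ∷ z) with heavy-values z
... | inj₁ refl = inj₁ refl
... | inj₂ 2≤   = inj₂ 2≤
heavy-values {suc d} (true ∷ z) with heavy-values z
... | inj₁ refl = inj₂ (ℚ.≤-reflexive (sym (cong (2ℚ ℚ.+_) (dot-0̂ {d} heavy))))
... | inj₂ 2≤   = inj₂ (ℚ.≤-trans (from-yes (2ℚ ℚ.≤? 2ℚ ℚ.+ 2ℚ)) (ℚ.+-monoʳ-≤ 2ℚ 2≤))

module _ {s l : ℚ} (l≤0 : l ℚ.≤ 0ℚ) (l≤s : l ℚ.≤ s) where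

  private
    SpikeValues : ∀ {d} → Fin d → Point d → Set
    SpikeValues i z = z ≡ 0̂ ⊎ z ≡ flip i 0̂ ⊎ 2ℚ ℚ.+ l ℚ.≤ dot (spike s i) z

    l≤2+l : l ℚ.≤ 2ℚ ℚ.+ l
    l≤2+l = ℚ.≤-trans (ℚ.≤-reflexive (sym (ℚ.+-identityˡ l)))
      (ℚ.+-monoˡ-≤ l (from-yes (0ℚ ℚ.≤? 2ℚ)))

    2+l≤2 : 2ℚ ℚ.+ l ℚ.≤ 2ℚ
    2+l≤2 = ℚ.≤-trans (ℚ.+-monoʳ-≤ 2ℚ l≤0) (ℚ.≤-reflexive (ℚ.+-identityʳ 2ℚ))

    bounded : ∀ {d} (i : Fin d) {z} → SpikeValues i z → l ℚ.≤ dot (spike s i) z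
    bounded i (inj₁ refl)        = ℚ.≤-trans l≤0 (ℚ.≤-reflexive (sym (dot-0̂ (spike s i))))
    bounded i (inj₂ (inj₁ refl)) = ℚ.≤-trans l≤s (ℚ.≤-reflexive (sym (dot-spike-flip s i)))
    bounded i (inj₂ (inj₂ 2+l≤)) = ℚ.≤-trans l≤2+l 2+l≤

  -- Coordinate `i` contributes 0 or `s`, both at least `l`, and every other coordinate that is set
  -- adds 2. The bound is applied with `s` equal to 0, 1 and -1.
  spike-values : ∀ {d} (i : Fin d) (z : Point d) →
                 z ≡ 0̂ ⊎ z ≡ flip i 0̂ ⊎ 2ℚ ℚ.+ l ℚ.≤ dot (spike s i) z
  spike-values zero (false ∷ z) with heavy-values z
  ... | inj₁ refl = inj₁ refl
  ... | inj₂ 2≤   = inj₂ (inj₂ (ℚ.≤-trans 2+l≤2 2≤))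
  spike-values zero (true ∷ z) with heavy-values z
  ... | inj₁ refl = inj₂ (inj₁ refl)
  ... | inj₂ 2≤   = inj₂ (inj₂ (ℚ.≤-trans (ℚ.≤-reflexive (ℚ.+-comm 2ℚ l)) (ℚ.+-mono-≤ l≤s 2≤)))
  spike-values (suc i) (false ∷ z) with spike-values i z
  ... | inj₁ refl        = inj₁ refl
  ... | inj₂ (inj₁ refl) = inj₂ (inj₁ refl)
  ... | inj₂ (inj₂ 2+l≤) = inj₂ (inj₂ 2+l≤)
  spike-values (suc i) (true ∷ z) =
    inj₂ (inj₂ (ℚ.+-monoʳ-≤ 2ℚ (bounded i (spike-values i z))))

-- Seen from `u`, the exceptional points are `u`, the corner that will be missing and the far end of
-- the diagonal. The fourth corner of the square has value 1 and falls under the last alternative.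
SeesawValues : ∀ {d} → Fin d → Fin d → Point d → Set
SeesawValues i j z =
  z ≡ 0̂ ⊎ z ≡ flip i 0̂ ⊎ z ≡ flip j (flip i 0̂) ⊎ 0ℚ ℚ.< dot (seesaw i j) z

seesaw-bounded : ∀ {d} (i j : Fin d) {z} → i ≢ j → SeesawValues i j z →
                 -1ℚ ℚ.≤ dot (seesaw i j) z
seesaw-bounded i j i≢j (inj₁ refl) =
  ℚ.≤-trans (from-yes (-1ℚ ℚ.≤? 0ℚ)) (ℚ.≤-reflexive (sym (dot-0̂ (seesaw i j))))
seesaw-bounded i j i≢j (inj₂ (inj₁ refl)) = ℚ.≤-reflexive (sym (dot-seesaw-flip i j i≢j))
seesaw-bounded i j i≢j (inj₂ (inj₂ (inj₁ refl))) =
  ℚ.≤-trans (from-yes (-1ℚ ℚ.≤? 0ℚ)) (ℚ.≤-reflexive (sym (dot-seesaw-flip₂ i j i≢j)))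
seesaw-bounded i j i≢j (inj₂ (inj₂ (inj₂ 0<))) =
  ℚ.≤-trans (from-yes (-1ℚ ℚ.≤? 0ℚ)) (ℚ.<⇒≤ 0<)

seesaw-values : ∀ {d} (i j : Fin d) → i ≢ j → (z : Point d) → SeesawValues i j z
seesaw-values zero zero i≢j z = contradiction refl i≢j
seesaw-values zero (suc j) i≢j (x ∷ z)
  with x | spike-values {1ℚ} {0ℚ} ℚ.≤-refl (from-yes (0ℚ ℚ.≤? 1ℚ)) j z
... | false | inj₁ refl        = inj₁ refl
... | false | inj₂ (inj₁ refl) = inj₂ (inj₂ (inj₂
  (ℚ.<-≤-trans (from-yes (0ℚ ℚ.<? 1ℚ)) (ℚ.≤-reflexive (sym (dot-spike-flip 1ℚ j))))))
... | false | inj₂ (inj₂ 2≤)   = inj₂ (inj₂ (inj₂ (ℚ.<-≤-trans (from-yes (0ℚ ℚ.<? 2ℚ ℚ.+ 0ℚ)) 2≤)))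
... | true  | inj₁ refl        = inj₂ (inj₁ refl)
... | true  | inj₂ (inj₁ refl) = inj₂ (inj₂ (inj₁ refl))
... | true  | inj₂ (inj₂ 2≤)   = inj₂ (inj₂ (inj₂
  (ℚ.<-≤-trans (from-yes (0ℚ ℚ.<? -1ℚ ℚ.+ (2ℚ ℚ.+ 0ℚ))) (ℚ.+-monoʳ-≤ -1ℚ 2≤))))
seesaw-values (suc i) zero i≢j (x ∷ z)
  with x | spike-values { -1ℚ} { -1ℚ} (from-yes (-1ℚ ℚ.≤? 0ℚ)) ℚ.≤-refl i z
... | false | inj₁ refl        = inj₁ refl
... | false | inj₂ (inj₁ refl) = inj₂ (inj₁ refl)
... | false | inj₂ (inj₂ 1≤)   = inj₂ (inj₂ (inj₂ (ℚ.<-≤-trans (from-yes (0ℚ ℚ.<? 2ℚ ℚ.+ -1ℚ)) 1≤)))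
... | true  | inj₁ refl        = inj₂ (inj₂ (inj₂
  (ℚ.<-≤-trans (from-yes (0ℚ ℚ.<? 1ℚ)) (ℚ.≤-reflexive (sym (cong (1ℚ ℚ.+_) (dot-0̂ (spike -1ℚ i))))))))
... | true  | inj₂ (inj₁ refl) = inj₂ (inj₂ (inj₁ refl))
... | true  | inj₂ (inj₂ 1≤)   = inj₂ (inj₂ (inj₂
  (ℚ.<-≤-trans (from-yes (0ℚ ℚ.<? 1ℚ ℚ.+ (2ℚ ℚ.+ -1ℚ))) (ℚ.+-monoʳ-≤ 1ℚ 1≤))))
seesaw-values (suc i) (suc j) i≢j (false ∷ z) with seesaw-values i j (i≢j ∘ cong suc) z
... | inj₁ refl               = inj₁ refl
... | inj₂ (inj₁ refl)        = inj₂ (inj₁ refl)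
... | inj₂ (inj₂ (inj₁ refl)) = inj₂ (inj₂ (inj₁ refl))
... | inj₂ (inj₂ (inj₂ 0<))   = inj₂ (inj₂ (inj₂ 0<))
seesaw-values (suc i) (suc j) i≢j (true ∷ z) = inj₂ (inj₂ (inj₂
  (ℚ.<-≤-trans (from-yes (0ℚ ℚ.<? 2ℚ ℚ.+ -1ℚ))
    (ℚ.+-monoʳ-≤ 2ℚ (seesaw-bounded i j i≢j′ (seesaw-values i j i≢j′ z))))))
  where i≢j′ = i≢j ∘ cong suc

flip-≢ : ∀ {d} (i : Fin d) u → u ≢ flip i u
flip-≢ zero    (true ∷ u)  ()
flip-≢ zero    (false ∷ u) ()
flip-≢ (suc i) (x ∷ u)     eq = flip-≢ i u (cong tail eq)

⊕-at : ∀ {d} (u : Point d) i → u ⊕ flip i 0̂ ≡ flip i u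
⊕-at u i = trans (⊕-flip u i 0̂) (cong (flip i) (⊕-0̂ u))

⊕-at₂ : ∀ {d} (u : Point d) i j → u ⊕ flip j (flip i 0̂) ≡ flip j (flip i u)
⊕-at₂ u i j = trans (⊕-flip u j _) (cong (flip j) (⊕-at u i))

⊕-difference : ∀ {d} {u v z : Point d} → u ⊕ z ≡ v → u ⊕ v ≡ z
⊕-difference {u = u} {z = z} refl = ⊕-cancel u z

-- With weight 0 in direction `i` and 2 elsewhere, the functional singles out this edge on the full
-- cube, and therefore on any `S` containing both ends.
cube-edge : ∀ {d} {S : List (Point d)} {u} i → u ∈ S → flip i u ∈ S → IsEdge S u (flip i u)
cube-edge {u = u} i u∈S v∈S = edge-criterion (spike 0ℚ i) u∈S v∈S (flip-≢ i u)
  (trans (cong (dot (spike 0ℚ i)) (⊕-difference (⊕-at u i))) (dot-spike-flip 0ℚ i)) drop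
  where
  drop : ∀ w → w ∈ _ → w ≢ u → w ≢ flip i u → 0ℚ ℚ.< dot (spike 0ℚ i) (u ⊕ w)
  drop w _ w≢u w≢v with spike-values {0ℚ} {0ℚ} ℚ.≤-refl ℚ.≤-refl i (u ⊕ w)
  ... | inj₁ eq        = contradiction (trans (⊕-solve eq) (⊕-0̂ u)) w≢u
  ... | inj₂ (inj₁ eq) = contradiction (trans (⊕-solve eq) (⊕-at u i)) w≢v
  ... | inj₂ (inj₂ 2≤) = ℚ.<-≤-trans (from-yes (0ℚ ℚ.<? 2ℚ ℚ.+ 0ℚ)) 2≤

-- Both ends tie at drop 0, and the only point of the cube with a negative drop is `flip i u`, which
-- is missing.
diagonal-edge : ∀ {d} {S : List (Point d)} {u} i j → i ≢ j → flip i u ∉ S →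
  u ∈ S → flip j (flip i u) ∈ S → u ≢ flip j (flip i u) → IsEdge S u (flip j (flip i u))
diagonal-edge {u = u} i j i≢j missing u∈S v∈S u≢v = edge-criterion (seesaw i j) u∈S v∈S u≢v
  (trans (cong (dot (seesaw i j)) (⊕-difference (⊕-at₂ u i j))) (dot-seesaw-flip₂ i j i≢j)) drop
  where
  drop : ∀ w → w ∈ _ → w ≢ u → w ≢ flip j (flip i u) → 0ℚ ℚ.< dot (seesaw i j) (u ⊕ w)
  drop w w∈S w≢u w≢v with seesaw-values i j i≢j (u ⊕ w)
  ... | inj₁ eq               = contradiction (trans (⊕-solve eq) (⊕-0̂ u)) w≢u
  ... | inj₂ (inj₁ eq)        = contradiction (subst (_∈ _) (trans (⊕-solve eq) (⊕-at u i)) w∈S) missing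
  ... | inj₂ (inj₂ (inj₁ eq)) = contradiction (trans (⊕-solve eq) (⊕-at₂ u i j)) w≢v
  ... | inj₂ (inj₂ (inj₂ 0<)) = 0<

-- Counting the edges across a vertex set

infix 4 _≟ᵖ_
_≟ᵖ_ : ∀ {d} → DecidableEquality (Point d)
_≟ᵖ_ = ≡-dec Bool._≟_

_∈?_ : ∀ {d} (u : Point d) (S : List (Point d)) → Dec (u ∈ S)
_∈?_ = DecMembership._∈?_ _≟ᵖ_

_∉?_ : ∀ {d} (u : Point d) (S : List (Point d)) → Dec (u ∉ S)
u ∉? S = ¬? (u ∈? S)

𝟙 : {P : Set} → Dec P → ℕ
𝟙 (yes _) = 1
𝟙 (no _)  = 0

𝟙-yes : {P : Set} (P? : Dec P) → P → 𝟙 P? ≡ 1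
𝟙-yes (yes _) _ = refl
𝟙-yes (no ¬p) p = contradiction p ¬p

𝟙-no : {P : Set} (P? : Dec P) → ¬ P → 𝟙 P? ≡ 0
𝟙-no (yes p) ¬p = contradiction p ¬p
𝟙-no (no _)  _  = refl

𝟙≤1 : {P : Set} (P? : Dec P) → 𝟙 P? ≤ 1
𝟙≤1 (yes _) = ≤-refl
𝟙≤1 (no _)  = z≤n

𝟙-cong : {P Q : Set} (P? : Dec P) (Q? : Dec Q) → (P → Q) → (Q → P) → 𝟙 P? ≡ 𝟙 Q?
𝟙-cong (yes p) Q? to from = sym (𝟙-yes Q? (to p))
𝟙-cong (no ¬p) Q? to from = sym (𝟙-no Q? (¬p ∘ from))

sublists-⊆ : {A : Set} (xs : List A) {ys : List A} → ys ∈ sublists xs →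
             ∀ {x} → x ∈ ys → x ∈ xs
sublists-⊆ []       (here refl) ()
sublists-⊆ (z ∷ xs) ys∈ x∈ with ∈-++⁻ (sublists xs) ys∈
... | inj₁ ys∈′ = there (sublists-⊆ xs ys∈′ x∈)
... | inj₂ ys∈′ with ∈-map⁻ (z ∷_) ys∈′ | x∈
... | _ , _ , refl    | here eq   = here eq
... | _ , zs∈ , refl  | there x∈′ = there (sublists-⊆ xs zs∈ x∈′)

sublists-Unique : {A : Set} (xs : List A) {ys : List A} → Unique xs →
                  ys ∈ sublists xs → Unique ys
sublists-Unique []       []          (here refl) = []
sublists-Unique (z ∷ xs) (z∉ ∷ uniq) ys∈ with ∈-++⁻ (sublists xs) ys∈
... | inj₁ ys∈′ = sublists-Unique xs uniq ys∈′
... | inj₂ ys∈′ with ∈-map⁻ (z ∷_) ys∈′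
... | _ , zs∈ , refl =
  All.tabulate (λ x∈ → All.lookup z∉ (sublists-⊆ xs zs∈ x∈)) ∷ sublists-Unique xs uniq zs∈

cube-Unique : ∀ d → Unique (cube d)
cube-Unique zero    = All.[] ∷ []
cube-Unique (suc d) = Unique.++⁺ (Unique.map⁺ (cong tail) (cube-Unique d))
  (Unique.map⁺ (cong tail) (cube-Unique d)) disjoint
  where
  disjoint : ∀ {v} → ¬ (v ∈ map (false ∷_) (cube d) × v ∈ map (true ∷_) (cube d))
  disjoint (v∈f , v∈t) with ∈-map⁻ (false ∷_) v∈f | ∈-map⁻ (true ∷_) v∈t
  ... | _ , _ , refl | _ , _ , ()

∑-point : ∀ {d} (y : Point d) → ∑[ x ← cube d ] 𝟙 (x ≟ᵖ y) ≡ 1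
∑-point {zero}  []      = refl
∑-point {suc d} (h ∷ y) = begin
  ∑[ x ← cube (suc d) ] 𝟙 (x ≟ᵖ h ∷ y)
    ≡⟨ ∑-cube-at h (λ x → 𝟙 (x ≟ᵖ h ∷ y)) ⟩
  ∑[ u ← cube d ] 𝟙 (h ∷ u ≟ᵖ h ∷ y) + ∑[ u ← cube d ] 𝟙 (not h ∷ u ≟ᵖ h ∷ y)
    ≡⟨ cong₂ _+_
         (trans (∑-cong (cube d) (λ u → 𝟙-cong (h ∷ u ≟ᵖ h ∷ y) (u ≟ᵖ y) (cong tail) (cong (h ∷_))))
                (∑-point y))
         (trans (∑-cong (cube d) (λ u → 𝟙-no (not h ∷ u ≟ᵖ h ∷ y) (not-¬ refl ∘ sym ∘ cong head)))
                (∑-0 (cube d))) ⟩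
  1 ∎
  where open ≡-Reasoning

length-as-∑ : ∀ {d} {xs : List (Point d)} → Unique xs → length xs ≡ ∑[ x ← cube d ] 𝟙 (x ∈? xs)
length-as-∑ {d} []                        = sym (∑-0 (cube d))
length-as-∑ {d} {y ∷ ys} (y∉ ∷ uniq) = begin
  1 + length ys
    ≡⟨ cong₂ _+_ (sym (∑-point y)) (length-as-∑ uniq) ⟩
  ∑[ x ← cube d ] 𝟙 (x ≟ᵖ y) + ∑[ x ← cube d ] 𝟙 (x ∈? ys)
    ≡⟨ ∑-+ (cube d) _ _ ⟨
  ∑[ x ← cube d ] (𝟙 (x ≟ᵖ y) + 𝟙 (x ∈? ys))
    ≡⟨ ∑-cong (cube d) split ⟨
  ∑[ x ← cube d ] 𝟙 (x ∈? (y ∷ ys)) ∎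
  where
  open ≡-Reasoning
  split : ∀ x → 𝟙 (x ∈? (y ∷ ys)) ≡ 𝟙 (x ≟ᵖ y) + 𝟙 (x ∈? ys)
  split x with x ≟ᵖ y
  ... | yes refl = cong suc (sym (𝟙-no (x ∈? ys) (λ x∈ → All.lookup y∉ x∈ refl)))
  ... | no x≢y   = 𝟙-cong _ (x ∈? ys)
    (λ { (here eq) → contradiction eq x≢y ; (there x∈) → x∈ }) there

length-filter-∑ : {A : Set} {P : A → Set} (P? : Decidable P) (xs : List A) →
                  length (filter P? xs) ≡ ∑[ x ← xs ] 𝟙 (P? x)
length-filter-∑ P? []       = refl
length-filter-∑ P? (x ∷ xs) with P? x
... | yes _ = cong suc (length-filter-∑ P? xs)
... | no _  = length-filter-∑ P? xs

∑-cartesianProduct : {A B : Set} (xs : List A) (ys : List B) (f : A × B → ℕ) →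
  ∑ (cartesianProduct xs ys) f ≡ ∑[ x ← xs ] ∑[ y ← ys ] f (x , y)
∑-cartesianProduct []       ys f = refl
∑-cartesianProduct (x ∷ xs) ys f = trans (∑-++ (map (x ,_) ys) _ f)
  (cong₂ _+_ (∑-map (x ,_) ys f) (∑-cartesianProduct xs ys f))

missing : ∀ {d} → List (Point d) → Point d → ℕ
missing S u = 𝟙 (u ∉? S)

module _ {d : ℕ} (S B : List (Point d)) where

  -- A decidable sufficient condition for `IsEdge`, which quantifies over functionals. `Diagonal`
  -- admits the degenerate case i = j, where v = u; `Crossing` excludes it by u ∈ B and v ∉ B.
  Adjacent Diagonal : Point d → Point d → Set
  Adjacent u v = ∃ λ i → v ≡ flip i u
  Diagonal u v = ∃ λ i → flip i u ∉ S × ∃ λ j → v ≡ flip j (flip i u)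

  Crossing : Point d × Point d → Set
  Crossing (u , v) = u ∈ B × (v ∈ S × v ∉ B) × (Adjacent u v ⊎ Diagonal u v)

  crossing? : Decidable Crossing
  crossing? (u , v) = u ∈? B ×-dec (v ∈? S ×-dec v ∉? B) ×-dec
    (Fin.any? (λ i → v ≟ᵖ flip i u) ⊎-dec
     Fin.any? (λ i → flip i u ∉? S ×-dec Fin.any? (λ j → v ≟ᵖ flip j (flip i u))))

  crossings : List (Point d × Point d)
  crossings = filter crossing? (cartesianProduct (cube d) (cube d))

  crossing-edge : (∀ {x} → x ∈ B → x ∈ S) → ∀ {u v} → Crossing (u , v) →
                  u ∈ B × v ∈ S × v ∉ B × IsEdge S u v
  crossing-edge B⊆S (u∈B , (v∈S , v∉B) , inj₁ (i , refl)) =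
    u∈B , v∈S , v∉B , cube-edge i (B⊆S u∈B) v∈S
  crossing-edge B⊆S {u} (u∈B , (v∈S , v∉B) , inj₂ (i , absent , j , refl)) =
    u∈B , v∈S , v∉B , diagonal-edge i j i≢j absent (B⊆S u∈B) v∈S u≢v
    where
    u≢v : u ≢ flip j (flip i u)
    u≢v eq = v∉B (subst (_∈ B) eq u∈B)
    i≢j : i ≢ j
    i≢j refl = u≢v (sym (flip-involutive i u))

  edges-across : (∀ {x} → x ∈ B → x ∈ S) → EdgesAcrossAtLeast S B (length crossings)
  edges-across B⊆S = crossings , refl ,
    Unique.filter⁺ crossing? (Unique.cartesianProduct⁺ (cube-Unique d) (cube-Unique d)) ,
    All.map (λ { {u , v} → crossing-edge B⊆S })
            (All.all-filter crossing? (cartesianProduct (cube d) (cube d)))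

  inside outside : Point d → ℕ
  inside u  = 𝟙 (u ∈? B)
  outside u = 𝟙 (u ∈? S ×-dec u ∉? B)

  partition : (∀ {x} → x ∈ B → x ∈ S) → ∀ u → inside u + outside u + missing S u ≡ 1
  partition B⊆S u with u ∈? B | u ∈? S
  ... | yes u∈B | yes _   = refl
  ... | yes u∈B | no u∉S  = contradiction (B⊆S u∈B) u∉S
  ... | no _    | yes _   = refl
  ... | no _    | no _    = refl

  private
    G : Point d → Point d → ℕ
    G u v = 𝟙 (crossing? (u , v))

    G-self : ∀ u → G u u ≡ 0
    G-self u = 𝟙-no (crossing? (u , u)) (λ { (u∈B , (_ , u∉B) , _) → u∉B u∈B })

    adjacent≤ : ∀ u i → inside u * outside (flip i u) ≤ G u (flip i u)
    adjacent≤ u i with u ∈? B | flip i u ∈? S ×-dec flip i u ∉? B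
    ... | no _    | _      = z≤n
    ... | yes _   | no _   = z≤n
    ... | yes u∈B | yes v∈ = ≤-reflexive (sym (𝟙-yes _ (u∈B , v∈ , inj₁ (i , refl))))

    diagonal≤ : ∀ u i j → inside u * (missing S (flip i u) * outside (flip j (flip i u)))
                          ≤ G u (flip j (flip i u))
    diagonal≤ u i j
      with u ∈? B | flip i u ∉? S | flip j (flip i u) ∈? S ×-dec flip j (flip i u) ∉? B
    ... | no _    | _       | _      = z≤n
    ... | yes _   | no _    | _      = z≤n
    ... | yes _   | yes _   | no _   = z≤n
    ... | yes u∈B | yes w∉S | yes v∈ =
      ≤-reflexive (sym (𝟙-yes _ (u∈B , v∈ , inj₂ (i , w∉S , j , refl))))

  -- For fixed `u` this is `∑-ball₂` applied to the indicator of crossing pairs: neighbours have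
  -- weight 2, points at distance two are reached through two midpoints, and the returns to `u`
  -- contribute nothing because `G u u` is 0.
  2*length-crossings :
    2 * cut inside outside +
    ∑[ w ← cube d ] (missing S w * (deg inside w * deg outside w)) ≤ 2 * length crossings
  2*length-crossings = begin
    2 * cut inside outside + ∑[ w ← cube d ] (missing S w * (deg inside w * deg outside w))
      ≡⟨ cong₂ _+_ (sym (∑-*ˡ (cube d) 2 _)) cliques ⟩
    ∑[ u ← cube d ] (2 * ∑[ i ← allFin d ] (inside u * outside (flip i u))) +
    ∑[ u ← cube d ] ∑[ i ← allFin d ] ∑[ j ← allFin d ]
      (inside u * (missing S (flip i u) * outside (flip j (flip i u))))
      ≡⟨ ∑-+ (cube d) _ _ ⟨
    ∑[ u ← cube d ] (2 * ∑[ i ← allFin d ] (inside u * outside (flip i u)) +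
      ∑[ i ← allFin d ] ∑[ j ← allFin d ]
        (inside u * (missing S (flip i u) * outside (flip j (flip i u)))))
      ≤⟨ ∑-mono (cube d) from-point ⟩
    ∑[ u ← cube d ] (2 * ∑ (cube d) (G u))
      ≡⟨ ∑-*ˡ (cube d) 2 _ ⟩
    2 * ∑[ u ← cube d ] ∑ (cube d) (G u)
      ≡⟨ cong (2 *_) (trans (length-filter-∑ crossing? (cartesianProduct (cube d) (cube d)))
                            (∑-cartesianProduct (cube d) (cube d) _)) ⟨
    2 * length crossings ∎
    where
    open ≤-Reasoning
    from-point : ∀ u →
      2 * ∑[ i ← allFin d ] (inside u * outside (flip i u)) +
      ∑[ i ← allFin d ] ∑[ j ← allFin d ]
        (inside u * (missing S (flip i u) * outside (flip j (flip i u))))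
      ≤ 2 * ∑ (cube d) (G u)
    from-point u = begin
      2 * ∑[ i ← allFin d ] (inside u * outside (flip i u)) +
      ∑[ i ← allFin d ] ∑[ j ← allFin d ]
        (inside u * (missing S (flip i u) * outside (flip j (flip i u))))
        ≤⟨ +-mono-≤ (*-monoʳ-≤ 2 (∑-mono (allFin d) (adjacent≤ u)))
                    (∑-mono (allFin d) (λ i → ∑-mono (allFin d) (diagonal≤ u i))) ⟩
      2 * ∑[ i ← allFin d ] G u (flip i u) +
      ∑[ i ← allFin d ] ∑[ j ← allFin d ] G u (flip j (flip i u))
        ≤⟨ ∑-ball₂ u (G u) ⟩
      2 * ∑ (cube d) (G u) + d * G u u
        ≡⟨ trans (cong (λ g → 2 * ∑ (cube d) (G u) + d * g) (G-self u))
             (trans (cong (2 * ∑ (cube d) (G u) +_) (*-zeroʳ d)) (+-identityʳ _)) ⟩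
      2 * ∑ (cube d) (G u) ∎
    -- The paths through a missing midpoint are indexed by their end in `B` instead, as `diagonal≤`
    -- requires.
    cliques : ∑[ w ← cube d ] (missing S w * (deg inside w * deg outside w)) ≡
      ∑[ u ← cube d ] ∑[ i ← allFin d ] ∑[ j ← allFin d ]
        (inside u * (missing S (flip i u) * outside (flip j (flip i u))))
    cliques = begin-equality
      ∑[ w ← cube d ] (missing S w * (deg inside w * deg outside w))
        ≡⟨ ∑-cong (cube d) (λ w → trans (cong (missing S w *_) (*-comm (deg inside w) _))
                                        (sym (*-assoc (missing S w) _ _))) ⟩
      ∑[ w ← cube d ] (missing S w * deg outside w * deg inside w)
        ≡⟨ cut-deg (λ w → missing S w * deg outside w) inside ⟨
      cut (λ w → missing S w * deg outside w) inside
        ≡⟨ cut-sym (λ w → missing S w * deg outside w) inside ⟩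
      ∑[ u ← cube d ] ∑[ i ← allFin d ] (inside u * (missing S (flip i u) * deg outside (flip i u)))
        ≡⟨ ∑-cong (cube d) (λ u → ∑-cong (allFin d) (λ i → trans
             (∑-*ˡ (allFin d) (inside u) _)
             (cong (inside u *_) (∑-*ˡ (allFin d) (missing S (flip i u)) _)))) ⟨
      ∑[ u ← cube d ] ∑[ i ← allFin d ] ∑[ j ← allFin d ]
        (inside u * (missing S (flip i u) * outside (flip j (flip i u)))) ∎

good-expansion : ∀ {d} {S : List (Point d)} → S ∈ sublists (cube d) →
  (∀ u → 3 * deg (missing S) u < d) → 10 * ∑ (cube d) (missing S) ≤ 2 ^ d →
  GoodExpansion d S
good-expansion {d} {S} S∈ sparse few B B∈ 4B≤3N =
  length (crossings S B) , edges-across S B B⊆S , bound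
  where
  B⊆S : ∀ {x} → x ∈ B → x ∈ S
  B⊆S = sublists-⊆ S B∈
  ∣B∣ : length B ≡ ∑ (cube d) (inside S B)
  ∣B∣ = length-as-∑ (sublists-Unique S (sublists-Unique (cube d) (cube-Unique d) S∈) B∈)
  open Expansion (inside S B) (outside S B) (missing S) (partition S B B⊆S) sparse
  bound : 2 ^ (d * length B) ≤ 2 ^ (8 * length (crossings S B)) * length B ^ length B
  bound = subst (λ n → 2 ^ (d * n) ≤ 2 ^ (8 * length (crossings S B)) * n ^ n) (sym ∣B∣)
    (expansion few (subst (λ n → 4 * n ≤ 3 * 2 ^ d) ∣B∣ 4B≤3N)
      (length (crossings S B)) (2*length-crossings S B))

-- Exponential moments and the probability bound

module ℚΣ = Summation (CommutativeRing.commutativeSemiring ℚ.+-*-commutativeRing)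

∑ℚ : {A : Set} → List A → (A → ℚ) → ℚ
∑ℚ = ℚΣ.∑

*-mono-≤-nonNeg : ∀ {p q r s} → 0ℚ ℚ.≤ r → 0ℚ ℚ.≤ q → p ℚ.≤ q → r ℚ.≤ s → p ℚ.* r ℚ.≤ q ℚ.* s
*-mono-≤-nonNeg {p} {q} {r} {s} 0≤r 0≤q p≤q r≤s = ℚ.≤-trans
  (ℚ.*-monoʳ-≤-nonNeg r {{ℚ.nonNegative 0≤r}} p≤q)
  (ℚ.*-monoˡ-≤-nonNeg q {{ℚ.nonNegative 0≤q}} r≤s)

*-nonNeg : ∀ {p q} → 0ℚ ℚ.≤ p → 0ℚ ℚ.≤ q → 0ℚ ℚ.≤ p ℚ.* q
*-nonNeg {p} {q} 0≤p 0≤q = ℚ.≤-trans (ℚ.≤-reflexive (sym (ℚ.*-zeroˡ q)))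
  (ℚ.*-monoʳ-≤-nonNeg q {{ℚ.nonNegative 0≤q}} 0≤p)

+-nonNeg : ∀ {p q} → 0ℚ ℚ.≤ p → 0ℚ ℚ.≤ q → 0ℚ ℚ.≤ p ℚ.+ q
+-nonNeg 0≤p 0≤q = ℚ.+-mono-≤ 0≤p 0≤q

p≤p+q : ∀ {p q} → 0ℚ ℚ.≤ q → p ℚ.≤ p ℚ.+ q
p≤p+q {p} 0≤q = ℚ.≤-trans (ℚ.≤-reflexive (sym (ℚ.+-identityʳ p))) (ℚ.+-monoʳ-≤ p 0≤q)

p≤q+p : ∀ {p q} → 0ℚ ℚ.≤ q → p ℚ.≤ q ℚ.+ p
p≤q+p {p} 0≤q = ℚ.≤-trans (ℚ.≤-reflexive (sym (ℚ.+-identityˡ p))) (ℚ.+-monoˡ-≤ p 0≤q)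

p≤q⇒0≤q-p : ∀ {p q} → p ℚ.≤ q → 0ℚ ℚ.≤ q ℚ.- p
p≤q⇒0≤q-p {p} p≤q = ℚ.≤-trans (ℚ.≤-reflexive (sym (ℚ.+-inverseʳ p))) (ℚ.+-monoˡ-≤ (ℚ.- p) p≤q)

^ℚ-nonNeg : ∀ {p} n → 0ℚ ℚ.≤ p → 0ℚ ℚ.≤ p ^ℚ n
^ℚ-nonNeg zero    0≤p = from-yes (0ℚ ℚ.≤? 1ℚ)
^ℚ-nonNeg (suc n) 0≤p = *-nonNeg 0≤p (^ℚ-nonNeg n 0≤p)

^ℚ-monoˡ-≤ : ∀ {p q} n → 0ℚ ℚ.≤ p → p ℚ.≤ q → p ^ℚ n ℚ.≤ q ^ℚ n
^ℚ-monoˡ-≤ zero    0≤p p≤q = ℚ.≤-refl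
^ℚ-monoˡ-≤ (suc n) 0≤p p≤q =
  *-mono-≤-nonNeg (^ℚ-nonNeg n 0≤p) (ℚ.≤-trans 0≤p p≤q) p≤q (^ℚ-monoˡ-≤ n 0≤p p≤q)

1≤^ℚ : ∀ {p} n → 1ℚ ℚ.≤ p → 1ℚ ℚ.≤ p ^ℚ n
1≤^ℚ zero    1≤p = ℚ.≤-refl
1≤^ℚ {p} (suc n) 1≤p = *-mono-≤-nonNeg {1ℚ} {p} {1ℚ} 0≤1 (ℚ.≤-trans 0≤1 1≤p) 1≤p (1≤^ℚ n 1≤p)
  where 0≤1 = from-yes (0ℚ ℚ.≤? 1ℚ)

^ℚ-+ : ∀ p m n → p ^ℚ (m + n) ≡ p ^ℚ m ℚ.* p ^ℚ n
^ℚ-+ p zero    n = sym (ℚ.*-identityˡ _)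
^ℚ-+ p (suc m) n = trans (cong (p ℚ.*_) (^ℚ-+ p m n)) (sym (ℚ.*-assoc p _ _))

^ℚ-* : ∀ p m n → p ^ℚ (m * n) ≡ (p ^ℚ n) ^ℚ m
^ℚ-* p zero    n = refl
^ℚ-* p (suc m) n = trans (^ℚ-+ p n (m * n)) (cong (p ^ℚ n ℚ.*_) (^ℚ-* p m n))

*-^ℚ : ∀ p q n → (p ℚ.* q) ^ℚ n ≡ p ^ℚ n ℚ.* q ^ℚ n
*-^ℚ p q zero    = refl
*-^ℚ p q (suc n) = trans (cong ((p ℚ.* q) ℚ.*_) (*-^ℚ p q n))
  (solve 4 (λ p q x y → (p :* q) :* (x :* y) := (p :* x) :* (q :* y)) refl p q (p ^ℚ n) (q ^ℚ n))
  where open +-*-Solver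

1^ℚ : ∀ n → 1ℚ ^ℚ n ≡ 1ℚ
1^ℚ zero    = refl
1^ℚ (suc n) = trans (ℚ.*-identityˡ _) (1^ℚ n)

^ℚ-monoʳ-≤ : ∀ {p m n} → 1ℚ ℚ.≤ p → m ≤ n → p ^ℚ m ℚ.≤ p ^ℚ n
^ℚ-monoʳ-≤ {p} {m} {n} 1≤p m≤n with m≤n⇒∃[o]m+o≡n m≤n
... | o , refl = ℚ.≤-trans (ℚ.≤-reflexive (sym (ℚ.*-identityʳ _))) (ℚ.≤-trans
  (ℚ.*-monoˡ-≤-nonNeg (p ^ℚ m) {{ℚ.nonNegative (^ℚ-nonNeg m 0≤p)}} (1≤^ℚ o 1≤p))
  (ℚ.≤-reflexive (sym (^ℚ-+ p m o))))
  where 0≤p = ℚ.≤-trans (from-yes (0ℚ ℚ.≤? 1ℚ)) 1≤p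

^ℚ-antiʳ-≤ : ∀ {p m n} → 0ℚ ℚ.≤ p → p ℚ.≤ 1ℚ → m ≤ n → p ^ℚ n ℚ.≤ p ^ℚ m
^ℚ-antiʳ-≤ {p} {m} 0≤p p≤1 m≤n with m≤n⇒∃[o]m+o≡n m≤n
... | o , refl = ℚ.≤-trans (ℚ.≤-reflexive (^ℚ-+ p m o)) (ℚ.≤-trans
  (ℚ.*-monoˡ-≤-nonNeg (p ^ℚ m) {{ℚ.nonNegative (^ℚ-nonNeg m 0≤p)}}
    (ℚ.≤-trans (^ℚ-monoˡ-≤ o 0≤p p≤1) (ℚ.≤-reflexive (1^ℚ o))))
  (ℚ.≤-reflexive (ℚ.*-identityʳ _)))

∑ℚ-mono-∈ : {A : Set} (xs : List A) {f g : A → ℚ} →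
            (∀ {x} → x ∈ xs → f x ℚ.≤ g x) → ∑ℚ xs f ℚ.≤ ∑ℚ xs g
∑ℚ-mono-∈ []       le = ℚ.≤-refl
∑ℚ-mono-∈ (x ∷ xs) le = ℚ.+-mono-≤ (le (here refl)) (∑ℚ-mono-∈ xs (le ∘ there))

∑ℚ-nonNeg : {A : Set} (xs : List A) {f : A → ℚ} → (∀ x → 0ℚ ℚ.≤ f x) → 0ℚ ℚ.≤ ∑ℚ xs f
∑ℚ-nonNeg []       0≤f = ℚ.≤-refl
∑ℚ-nonNeg (x ∷ xs) 0≤f = +-nonNeg (0≤f x) (∑ℚ-nonNeg xs 0≤f)

∑ℚ-term-∈ : {A : Set} {xs : List A} {x : A} {f : A → ℚ} →
            (∀ x → 0ℚ ℚ.≤ f x) → x ∈ xs → f x ℚ.≤ ∑ℚ xs f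
∑ℚ-term-∈ {xs = _ ∷ xs} 0≤f (here refl) = p≤p+q (∑ℚ-nonNeg xs 0≤f)
∑ℚ-term-∈ {xs = y ∷ xs} 0≤f (there x∈)  = ℚ.≤-trans (∑ℚ-term-∈ 0≤f x∈) (p≤q+p (0≤f y))

∑ℚ-cube-const : ∀ d x → ∑ℚ (cube d) (λ _ → x) ≡ (1ℚ ℚ.+ 1ℚ) ^ℚ d ℚ.* x
∑ℚ-cube-const zero    x = trans (ℚ.+-identityʳ x) (sym (ℚ.*-identityˡ x))
∑ℚ-cube-const (suc d) x = trans (ℚΣ.∑-++ (map (false ∷_) (cube d)) _ _)
  (trans (cong₂ ℚ._+_ (trans (ℚΣ.∑-map (false ∷_) (cube d) _) (∑ℚ-cube-const d x))
                      (trans (ℚΣ.∑-map (true ∷_) (cube d) _) (∑ℚ-cube-const d x)))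
         (solve 2 (λ y x → y :* x :+ y :* x := ((con 1ℚ :+ con 1ℚ) :* y) :* x) refl ((1ℚ ℚ.+ 1ℚ) ^ℚ d) x))
  where open +-*-Solver

sumℚ-map : {A : Set} (f : A → ℚ) (xs : List A) → sumℚ (map f xs) ≡ ∑ℚ xs f
sumℚ-map f []       = refl
sumℚ-map f (x ∷ xs) = cong (f x ℚ.+_) (sumℚ-map f xs)

select-does : {A : Set} {P : A → Set} (P? : Decidable P) (xs : List A) →
              select (map (does ∘ P?) xs) xs ≡ filter P? xs
select-does P? []       = refl
select-does P? (x ∷ xs) with P? x
... | yes _ = cong (x ∷_) (select-does P? xs)
... | no _  = select-does P? xs

-- An outcome in `P` is paid for by the filtered sum. Outside `P` the weight w is at most w · z.
markov : {A : Set} {P : A → Set} (P? : Decidable P) (w z : A → ℚ) →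
  (∀ x → 0ℚ ℚ.≤ w x) → (∀ x → 0ℚ ℚ.≤ z x) → (∀ x → ¬ P x → 1ℚ ℚ.≤ z x) →
  ∀ xs → ∑ℚ xs w ℚ.≤ ∑ℚ (filter P? xs) w ℚ.+ ∑ℚ xs (λ x → w x ℚ.* z x)
markov P? w z 0≤w 0≤z 1≤z []       = ℚ.≤-refl
markov P? w z 0≤w 0≤z 1≤z (x ∷ xs) with P? x
... | yes _ = ℚ.≤-trans (ℚ.+-monoʳ-≤ (w x) (markov P? w z 0≤w 0≤z 1≤z xs))
  (ℚ.≤-trans (p≤p+q (*-nonNeg (0≤w x) (0≤z x)))
    (ℚ.≤-reflexive (solve 4 (λ a b c e → (a :+ (b :+ c)) :+ e := (a :+ b) :+ (e :+ c)) refl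
      (w x) (∑ℚ (filter P? xs) w) (∑ℚ xs (λ x → w x ℚ.* z x)) (w x ℚ.* z x))))
  where open +-*-Solver
... | no ¬p = ℚ.≤-trans (ℚ.+-mono-≤ w≤wz (markov P? w z 0≤w 0≤z 1≤z xs))
  (ℚ.≤-reflexive (solve 3 (λ a b c → c :+ (a :+ b) := a :+ (c :+ b)) refl
      (∑ℚ (filter P? xs) w) (∑ℚ xs (λ x → w x ℚ.* z x)) (w x ℚ.* z x)))
  where
  open +-*-Solver
  w≤wz : w x ℚ.≤ w x ℚ.* z x
  w≤wz = ℚ.≤-trans (ℚ.≤-reflexive (sym (ℚ.*-identityʳ (w x))))
    (ℚ.*-monoˡ-≤-nonNeg (w x) {{ℚ.nonNegative (0≤w x)}} (1≤z x ¬p))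

sublists-length : {A : Set} (xs : List A) {ys : List A} → ys ∈ sublists xs → length ys ≤ length xs
sublists-length []       (here refl) = z≤n
sublists-length (x ∷ xs) ys∈ with ∈-++⁻ (sublists xs) ys∈
... | inj₁ ys∈′ = ≤-trans (sublists-length xs ys∈′) (n≤1+n _)
... | inj₂ ys∈′ with ∈-map⁻ (x ∷_) ys∈′
... | _ , zs∈ , refl = s≤s (sublists-length xs zs∈)

length-cube : ∀ d → length (cube d) ≡ 2 ^ d
length-cube zero    = refl
length-cube (suc d) = trans (length-++ (map (false ∷_) (cube d)))
  (cong₂ _+_ (trans (length-map (false ∷_) (cube d)) (length-cube d))
    (trans (length-map (true ∷_) (cube d)) (trans (length-cube d) (sym (+-identityʳ (2 ^ d))))))

∈-cube : ∀ {d} (u : Point d) → u ∈ cube d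
∈-cube []          = here refl
∈-cube (false ∷ u) = ∈-++⁺ˡ (∈-map⁺ (false ∷_) (∈-cube u))
∈-cube (true ∷ u)  = ∈-++⁺ʳ (map (false ∷_) (cube _)) (∈-map⁺ (true ∷_) (∈-cube u))

missed : ∀ {d} → (Point d → ℕ) → List (Point d) → List (Point d) → ℕ
missed k xs S = ∑[ x ← xs ] (k x * missing S x)

module _ {d : ℕ} (q c : ℚ) (k : Point d → ℕ) (k≤1 : ∀ x → k x ≤ 1) where

  private
    p : ℚ
    p = 1ℚ ℚ.- q

    term : List (Point d) → List (Point d) → ℚ
    term xs S = (q ^ℚ length S ℚ.* p ^ℚ (length xs ∸ length S)) ℚ.* c ^ℚ missed k xs S

    term-without : ∀ x xs {S} → x ∉ xs → S ∈ sublists xs →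
                   term (x ∷ xs) S ≡ (p ℚ.* c ^ℚ k x) ℚ.* term xs S
    term-without x xs {S} x∉ S∈ = trans
      (cong₂ (λ m n → (q ^ℚ length S ℚ.* p ^ℚ m) ℚ.* c ^ℚ n)
        (+-∸-assoc 1 (sublists-length xs S∈))
        (cong (_+ missed k xs S) (trans
          (cong (k x *_) (𝟙-yes (x ∉? S) (x∉ ∘ sublists-⊆ xs S∈))) (*-identityʳ (k x)))))
      (trans (cong ((q ^ℚ length S ℚ.* (p ℚ.* p ^ℚ (length xs ∸ length S))) ℚ.*_)
          (^ℚ-+ c (k x) (missed k xs S)))
        (solve 5 (λ a p b e f → (a :* (p :* b)) :* (e :* f) := (p :* e) :* ((a :* b) :* f)) refl
          (q ^ℚ length S) p (p ^ℚ (length xs ∸ length S)) (c ^ℚ k x) (c ^ℚ missed k xs S)))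
      where open +-*-Solver

    term-with : ∀ x xs S → x ∉ xs → term (x ∷ xs) (x ∷ S) ≡ q ℚ.* term xs S
    term-with x xs S x∉ = trans
      (cong (λ n → ((q ℚ.* q ^ℚ length S) ℚ.* p ^ℚ (length xs ∸ length S)) ℚ.* c ^ℚ n)
        (cong₂ _+_ (trans (cong (k x *_) (𝟙-no (x ∉? (x ∷ S)) (λ x∉S → x∉S (here refl))))
                   (*-zeroʳ (k x)))
          (∑-cong-∈ xs (λ {y} y∈ → cong (k y *_) (𝟙-cong (y ∉? (x ∷ S)) (y ∉? S) (_∘ there)
            (λ y∉S → λ { (here refl) → x∉ y∈ ; (there y∈S) → y∉S y∈S }))))))
      (solve 4 (λ q a b e → ((q :* a) :* b) :* e := q :* ((a :* b) :* e)) refl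
        q (q ^ℚ length S) (p ^ℚ (length xs ∸ length S)) (c ^ℚ missed k xs S))
      where open +-*-Solver

    factor : ∀ n → n ≤ 1 → p ℚ.* c ^ℚ n ℚ.+ q ≡ (q ℚ.+ p ℚ.* c) ^ℚ n
    factor zero    _ = solve 1 (λ q → (con 1ℚ :- q) :* con 1ℚ :+ q := con 1ℚ) refl q
      where open +-*-Solver
    factor (suc zero) _ = solve 2
      (λ q c → (con 1ℚ :- q) :* (c :* con 1ℚ) :+ q := (q :+ (con 1ℚ :- q) :* c) :* con 1ℚ) refl q c
      where open +-*-Solver
    factor (suc (suc n)) (s≤s ())

  -- Independence of the points: leaving `x` out contributes the factor p c^(k x), keeping it
  -- contributes q, and their sum is (q + pc)^(k x) because `k x` is 0 or 1. A general list `xs`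
  -- lets the induction follow `sublists`.
  exponential-moment : ∀ xs → Unique xs →
    ∑ℚ (sublists xs) (λ S →
      (q ^ℚ length S ℚ.* (1ℚ ℚ.- q) ^ℚ (length xs ∸ length S)) ℚ.* c ^ℚ missed k xs S)
    ≡ (q ℚ.+ (1ℚ ℚ.- q) ℚ.* c) ^ℚ ∑ xs k
  exponential-moment []       _           = refl
  exponential-moment (x ∷ xs) (x∉ ∷ uniq) = begin
    ∑ℚ (sublists xs ++ map (x ∷_) (sublists xs)) (term (x ∷ xs))
      ≡⟨ ℚΣ.∑-++ (sublists xs) _ _ ⟩
    ∑ℚ (sublists xs) (term (x ∷ xs)) ℚ.+ ∑ℚ (map (x ∷_) (sublists xs)) (term (x ∷ xs))
      ≡⟨ cong₂ ℚ._+_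
           (trans (ℚΣ.∑-cong-∈ (sublists xs) (term-without x xs x∉xs))
             (ℚΣ.∑-*ˡ (sublists xs) (p ℚ.* c ^ℚ k x) (term xs)))
           (trans (ℚΣ.∑-map (x ∷_) (sublists xs) _)
             (trans (ℚΣ.∑-cong (sublists xs) (λ S → term-with x xs S x∉xs))
               (ℚΣ.∑-*ˡ (sublists xs) q (term xs)))) ⟩
    (p ℚ.* c ^ℚ k x) ℚ.* ∑ℚ (sublists xs) (term xs) ℚ.+ q ℚ.* ∑ℚ (sublists xs) (term xs)
      ≡⟨ ℚ.*-distribʳ-+ _ (p ℚ.* c ^ℚ k x) q ⟨
    (p ℚ.* c ^ℚ k x ℚ.+ q) ℚ.* ∑ℚ (sublists xs) (term xs)
      ≡⟨ cong₂ ℚ._*_ (factor (k x) (k≤1 x)) (exponential-moment xs uniq) ⟩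
    (q ℚ.+ p ℚ.* c) ^ℚ k x ℚ.* (q ℚ.+ p ℚ.* c) ^ℚ ∑ xs k
      ≡⟨ ^ℚ-+ (q ℚ.+ p ℚ.* c) (k x) (∑ xs k) ⟨
    (q ℚ.+ p ℚ.* c) ^ℚ (k x + ∑ xs k) ∎
    where
    open ≡-Reasoning
    x∉xs : x ∉ xs
    x∉xs x∈ = All.lookup x∉ x∈ refl

  weighted-moment : ∑ℚ (sublists (cube d)) (λ S → weight d q S ℚ.* c ^ℚ missed k (cube d) S)
                    ≡ (q ℚ.+ (1ℚ ℚ.- q) ℚ.* c) ^ℚ ∑ (cube d) k
  weighted-moment = trans
    (cong (λ n → ∑ℚ (sublists (cube d)) (λ S →
       (q ^ℚ length S ℚ.* (1ℚ ℚ.- q) ^ℚ (n ∸ length S)) ℚ.* c ^ℚ missed k (cube d) S))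
      (sym (length-cube d)))
    (exponential-moment (cube d) (cube-Unique d))

-- The moment with k = 0 and c = 1, whose right side is a zeroth power.
total-weight : ∀ d q → ∑ℚ (sublists (cube d)) (weight d q) ≡ 1ℚ
total-weight d q = trans
  (ℚΣ.∑-cong (sublists (cube d)) (λ S → sym (trans
    (cong (weight d q S ℚ.*_) (1^ℚ (missed (λ _ → 0) (cube d) S))) (ℚ.*-identityʳ _))))
  (trans (weighted-moment {d} q 1ℚ (λ _ → 0) (λ _ → z≤n))
    (cong ((q ℚ.+ (1ℚ ℚ.- q) ℚ.* 1ℚ) ^ℚ_) (∑-0 (cube d))))

neighbour : ∀ {d} → Point d → Point d → ℕ
neighbour w x = 𝟙 (Fin.any? (λ i → x ≟ᵖ flip i w))

∑-neighbour≤d : ∀ {d} (w : Point d) → ∑ (cube d) (neighbour w) ≤ d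
∑-neighbour≤d {d} w = begin
  ∑ (cube d) (neighbour w)
    ≤⟨ ∑-mono (cube d) pointwise ⟩
  ∑[ x ← cube d ] ∑[ i ← allFin d ] 𝟙 (x ≟ᵖ flip i w)
    ≡⟨ ∑-swap (cube d) (allFin d) _ ⟩
  ∑[ i ← allFin d ] ∑[ x ← cube d ] 𝟙 (x ≟ᵖ flip i w)
    ≡⟨ ∑-cong (allFin d) (λ i → ∑-point (flip i w)) ⟩
  ∑[ i ← allFin d ] 1
    ≡⟨ ∑-allFin-1 d ⟩
  d ∎
  where
  open ≤-Reasoning
  pointwise : ∀ x → neighbour w x ≤ ∑[ i ← allFin d ] 𝟙 (x ≟ᵖ flip i w)
  pointwise x with Fin.any? (λ i → x ≟ᵖ flip i w)
  ... | no _         = z≤n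
  ... | yes (i , eq) = ≤-trans (≤-reflexive (sym (𝟙-yes (x ≟ᵖ flip i w) eq)))
    (∑-term-∈ (λ i → 𝟙 (x ≟ᵖ flip i w)) (∈-allFin i))

deg≤missed-neighbours : ∀ {d} (S : List (Point d)) w →
  deg (missing S) w ≤ missed (neighbour w) (cube d) S
deg≤missed-neighbours {d} S w = ≤-trans
  (≤-reflexive (∑-cong (allFin d) (λ i → sym (trans
    (cong (_* missing S (flip i w)) (𝟙-yes (Fin.any? (λ j → flip i w ≟ᵖ flip j w)) (i , refl)))
    (+-identityʳ _)))))
  (≤-trans (m≤n+m _ _) (∑-ball₁ w (λ x → neighbour w x * missing S x)))

-- Chernoff's step for the event m ≥ n/k, with r = 1/s. Taking `s ^ℚ k` as the base of the moment
-- avoids fractional exponents.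
tail-factor : ∀ {r s} k {n m} → r ℚ.* s ≡ 1ℚ → 0ℚ ℚ.≤ r → 1ℚ ℚ.≤ s → n ≤ k * m →
              1ℚ ℚ.≤ r ^ℚ n ℚ.* (s ^ℚ k) ^ℚ m
tail-factor {r} {s} k {n} {m} rs≡1 0≤r 1≤s n≤km = ℚ.≤-trans
  (ℚ.≤-reflexive (sym (trans (sym (*-^ℚ r s n)) (trans (cong (_^ℚ n) rs≡1) (1^ℚ n)))))
  (ℚ.*-monoˡ-≤-nonNeg (r ^ℚ n) {{ℚ.nonNegative (^ℚ-nonNeg n 0≤r)}}
    (ℚ.≤-trans (^ℚ-monoʳ-≤ 1≤s n≤km)
      (ℚ.≤-reflexive (trans (cong (s ^ℚ_) (*-comm k m)) (^ℚ-* s m k)))))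

n≤2^n : ∀ n → n ≤ 2 ^ n
n≤2^n zero    = z≤n
n≤2^n (suc n) = +-mono-≤ (m^n>0 2 n) (≤-trans (n≤2^n n) (m≤m+n _ 0))

3ℚ ⅓ 11/10 10/11 : ℚ
3ℚ    = ℤ.+ 3 ℚ./ 1
⅓     = ℤ.+ 1 ℚ./ 3
11/10 = ℤ.+ 11 ℚ./ 10
10/11 = ℤ.+ 10 ℚ./ 11

80/81 : ℚ
80/81 = ℤ.+ 80 ℚ./ 81

module Random {d : ℕ} (q : ℚ) (q≤1 : q ℚ.≤ 1ℚ) (rare : (1ℚ ℚ.- q) ℚ.* (ℤ.+ 54 ℚ./ 1) ℚ.≤ 1ℚ) where

  private
    p : ℚ
    p = 1ℚ ℚ.- q
    1/54 : ℚ
    1/54 = ℤ.+ 1 ℚ./ 54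
    open +-*-Solver

  0≤p : 0ℚ ℚ.≤ p
  0≤p = p≤q⇒0≤q-p q≤1

  p≤1/54 : p ℚ.≤ 1/54
  p≤1/54 = ℚ.≤-trans
    (ℚ.≤-reflexive (solve 1 (λ p → p := (p :* con (ℤ.+ 54 ℚ./ 1)) :* con (ℤ.+ 1 ℚ./ 54)) refl p))
    (ℚ.*-monoʳ-≤-nonNeg 1/54 rare)

  0≤q : 0ℚ ℚ.≤ q
  0≤q = ℚ.≤-trans (from-yes (0ℚ ℚ.≤? 1ℚ ℚ.- 1/54)) (ℚ.≤-trans
    (ℚ.+-monoʳ-≤ 1ℚ (ℚ.neg-antimono-≤ p≤1/54))
    (ℚ.≤-reflexive (solve 1 (λ q → con 1ℚ :- (con 1ℚ :- q) := q) refl q)))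

  0≤weight : ∀ S → 0ℚ ℚ.≤ weight d q S
  0≤weight S = *-nonNeg (^ℚ-nonNeg (length S) 0≤q) (^ℚ-nonNeg (2 ^ d ∸ length S) 0≤p)

  base-≤ : ∀ {c} → 1ℚ ℚ.≤ c → q ℚ.+ p ℚ.* c ℚ.≤ 1ℚ ℚ.+ 1/54 ℚ.* (c ℚ.- 1ℚ)
  base-≤ {c} 1≤c = ℚ.≤-trans
    (ℚ.≤-reflexive (solve 2
      (λ q c → q :+ (con 1ℚ :- q) :* c := con 1ℚ :+ (con 1ℚ :- q) :* (c :- con 1ℚ)) refl q c))
    (ℚ.+-monoʳ-≤ 1ℚ (ℚ.*-monoʳ-≤-nonNeg (c ℚ.- 1ℚ) {{ℚ.nonNegative (p≤q⇒0≤q-p 1≤c)}} p≤1/54))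

  0≤base : ∀ {c} → 0ℚ ℚ.≤ c → 0ℚ ℚ.≤ q ℚ.+ p ℚ.* c
  0≤base 0≤c = +-nonNeg 0≤q (*-nonNeg 0≤p 0≤c)

  -- Chernoff parameters 3³ and (11/10)¹⁰ for the thresholds d/3 and 2^d/10.
  c₁ c₂ : ℚ
  c₁ = 3ℚ ^ℚ 3
  c₂ = 11/10 ^ℚ 10

  0≤c₁ : 0ℚ ℚ.≤ c₁
  0≤c₁ = from-yes (0ℚ ℚ.≤? c₁)

  0≤c₂ : 0ℚ ℚ.≤ c₂
  0≤c₂ = from-yes (0ℚ ℚ.≤? c₂)

  Dense Few Good : List (Point d) → Set
  Dense S = Any (λ w → d ≤ 3 * deg (missing S) w) (cube d)
  Few S   = 10 * ∑ (cube d) (missing S) ≤ 2 ^ d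
  Good S  = ¬ Dense S × Few S

  dense? : Decidable Dense
  dense? S = any? (λ w → d ≤? 3 * deg (missing S) w) (cube d)

  few? : Decidable Few
  few? S = 10 * ∑ (cube d) (missing S) ≤? 2 ^ d

  good? : Decidable Good
  good? S = ¬? (dense? S) ×-dec few? S

  good⇒expansion : ∀ {S} → S ∈ sublists (cube d) → Good S → GoodExpansion d S
  good⇒expansion S∈ (sparse , few) =
    good-expansion S∈ (λ u → ≰⇒> (λ dense → sparse (lose (∈-cube u) dense))) few

  local global : List (Point d) → ℚ
  local S  = ∑ℚ (cube d) (λ w → c₁ ^ℚ missed (neighbour w) (cube d) S)
  global S = c₂ ^ℚ missed (λ _ → 1) (cube d) S

  -- One normalised exponential per point and one for the whole cube. Any single failure already
  -- makes the sum at least 1, so its expectation contains both the Chernoff bounds and the union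
  -- bound.
  charge : List (Point d) → ℚ
  charge S = ⅓ ^ℚ d ℚ.* local S ℚ.+ 10/11 ^ℚ (2 ^ d) ℚ.* global S

  0≤⅓^ : ∀ n → 0ℚ ℚ.≤ ⅓ ^ℚ n
  0≤⅓^ n = ^ℚ-nonNeg n (from-yes (0ℚ ℚ.≤? ⅓))

  0≤10/11^ : ∀ n → 0ℚ ℚ.≤ 10/11 ^ℚ n
  0≤10/11^ n = ^ℚ-nonNeg n (from-yes (0ℚ ℚ.≤? 10/11))

  0≤local : ∀ S → 0ℚ ℚ.≤ ⅓ ^ℚ d ℚ.* local S
  0≤local S = *-nonNeg (0≤⅓^ d)
    (∑ℚ-nonNeg (cube d) (λ w → ^ℚ-nonNeg (missed (neighbour w) (cube d) S) 0≤c₁))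

  0≤global : ∀ S → 0ℚ ℚ.≤ 10/11 ^ℚ (2 ^ d) ℚ.* global S
  0≤global S = *-nonNeg (0≤10/11^ (2 ^ d)) (^ℚ-nonNeg (missed (λ _ → 1) (cube d) S) 0≤c₂)

  dense⇒1≤charge : ∀ S → Dense S → 1ℚ ℚ.≤ ⅓ ^ℚ d ℚ.* local S
  dense⇒1≤charge S dense = let w , w∈ , d≤ = find dense in ℚ.≤-trans
    (tail-factor {⅓} {3ℚ} 3 {m = missed (neighbour w) (cube d) S} refl
      (from-yes (0ℚ ℚ.≤? ⅓)) (from-yes (1ℚ ℚ.≤? 3ℚ))
      (≤-trans d≤ (*-monoʳ-≤ 3 (deg≤missed-neighbours S w))))
    (ℚ.*-monoˡ-≤-nonNeg (⅓ ^ℚ d) {{ℚ.nonNegative (0≤⅓^ d)}}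
      (∑ℚ-term-∈ (λ w → ^ℚ-nonNeg (missed (neighbour w) (cube d) S) 0≤c₁) w∈))

  many⇒1≤charge : ∀ S → ¬ Few S → 1ℚ ℚ.≤ 10/11 ^ℚ (2 ^ d) ℚ.* global S
  many⇒1≤charge S many =
    tail-factor {10/11} {11/10} 10 {m = missed (λ _ → 1) (cube d) S} refl
      (from-yes (0ℚ ℚ.≤? 10/11)) (from-yes (1ℚ ℚ.≤? 11/10))
      (≤-trans (<⇒≤ (≰⇒> many))
        (≤-reflexive (cong (10 *_) (∑-cong (cube d) (λ x → sym (+-identityʳ _))))))

  bad⇒1≤charge : ∀ S → ¬ Good S → 1ℚ ℚ.≤ charge S
  bad⇒1≤charge S bad = cases (dense? S) (few? S)
    where
    cases : Dec (Dense S) → Dec (Few S) → 1ℚ ℚ.≤ charge S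
    cases (yes dense)  _         = ℚ.≤-trans (dense⇒1≤charge S dense) (p≤p+q (0≤global S))
    cases (no _)      (no many)  = ℚ.≤-trans (many⇒1≤charge S many) (p≤q+p (0≤local S))
    cases (no sparse) (yes few)  = contradiction (sparse , few) bad

  expected-charge : ∑ℚ (sublists (cube d)) (λ S → weight d q S ℚ.* charge S) ≡
    ⅓ ^ℚ d ℚ.* ∑ℚ (cube d) (λ w → (q ℚ.+ p ℚ.* c₁) ^ℚ ∑ (cube d) (neighbour w)) ℚ.+
    10/11 ^ℚ (2 ^ d) ℚ.* (q ℚ.+ p ℚ.* c₂) ^ℚ (2 ^ d)
  expected-charge = begin
    ∑ℚ Ω (λ S → weight d q S ℚ.* charge S)
      ≡⟨ ℚΣ.∑-cong Ω (λ S → trans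
           (solve 5 (λ w a l b g → w :* (a :* l :+ b :* g) := a :* (w :* l) :+ b :* (w :* g)) refl
             (weight d q S) (⅓ ^ℚ d) (local S) (10/11 ^ℚ (2 ^ d)) (global S))
           (cong (λ x → ⅓ ^ℚ d ℚ.* x ℚ.+ 10/11 ^ℚ (2 ^ d) ℚ.* (weight d q S ℚ.* global S))
             (sym (ℚΣ.∑-*ˡ (cube d) (weight d q S) _)))) ⟩
    ∑ℚ Ω (λ S → ⅓ ^ℚ d ℚ.* localʷ S ℚ.+ 10/11 ^ℚ (2 ^ d) ℚ.* globalʷ S)
      ≡⟨ trans (ℚΣ.∑-+ Ω _ _)
           (cong₂ ℚ._+_ (ℚΣ.∑-*ˡ Ω (⅓ ^ℚ d) localʷ) (ℚΣ.∑-*ˡ Ω (10/11 ^ℚ (2 ^ d)) globalʷ)) ⟩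
    ⅓ ^ℚ d ℚ.* ∑ℚ Ω localʷ ℚ.+ 10/11 ^ℚ (2 ^ d) ℚ.* ∑ℚ Ω globalʷ
      ≡⟨ cong₂ (λ x y → ⅓ ^ℚ d ℚ.* x ℚ.+ 10/11 ^ℚ (2 ^ d) ℚ.* y)
           (trans (ℚΣ.∑-swap Ω (cube d) _) (ℚΣ.∑-cong (cube d) (λ w →
             weighted-moment q c₁ (neighbour w) (λ x → 𝟙≤1 (Fin.any? (λ i → x ≟ᵖ flip i w))))))
           (trans (weighted-moment {d} q c₂ (λ _ → 1) (λ _ → ≤-refl))
             (cong ((q ℚ.+ p ℚ.* c₂) ^ℚ_) (∑-cube-1 d))) ⟩
    ⅓ ^ℚ d ℚ.* ∑ℚ (cube d) (λ w → (q ℚ.+ p ℚ.* c₁) ^ℚ ∑ (cube d) (neighbour w)) ℚ.+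
    10/11 ^ℚ (2 ^ d) ℚ.* (q ℚ.+ p ℚ.* c₂) ^ℚ (2 ^ d) ∎
    where
    open ≡-Reasoning
    Ω = sublists (cube d)
    localʷ globalʷ : List (Point d) → ℚ
    localʷ S  = ∑ℚ (cube d) (λ w → weight d q S ℚ.* c₁ ^ℚ missed (neighbour w) (cube d) S)
    globalʷ S = weight d q S ℚ.* global S

  charge-≤ : ∑ℚ (sublists (cube d)) (λ S → weight d q S ℚ.* charge S) ℚ.≤ 80/81 ^ℚ d ℚ.+ 80/81 ^ℚ d
  charge-≤ = ℚ.≤-trans (ℚ.≤-reflexive expected-charge) (ℚ.+-mono-≤ local-≤ global-≤)
    where
    -- 40/27 = 1 + 26/54 belongs to `c₁` = 27, and 2 · 1/3 · 40/27 = 80/81, where the 2 comes from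
    -- the union bound over 2^d points. 88/81 is a generous bound on 1 + (c₂ - 1)/54, chosen so that
    -- 10/11 · 88/81 = 80/81 as well.
    40/27 88/81 : ℚ
    40/27 = ℤ.+ 40 ℚ./ 27
    88/81 = ℤ.+ 88 ℚ./ 81
    local-≤ : ⅓ ^ℚ d ℚ.* ∑ℚ (cube d) (λ w → (q ℚ.+ p ℚ.* c₁) ^ℚ ∑ (cube d) (neighbour w)) ℚ.≤ 80/81 ^ℚ d
    local-≤ = ℚ.≤-trans
      (ℚ.*-monoˡ-≤-nonNeg (⅓ ^ℚ d) {{ℚ.nonNegative (0≤⅓^ d)}} (∑ℚ-mono-∈ (cube d) (λ {w} _ → ℚ.≤-trans
        (^ℚ-monoˡ-≤ (∑ (cube d) (neighbour w)) (0≤base 0≤c₁)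
          (ℚ.≤-trans (base-≤ (from-yes (1ℚ ℚ.≤? c₁)))
            (from-yes (1ℚ ℚ.+ 1/54 ℚ.* (c₁ ℚ.- 1ℚ) ℚ.≤? 40/27))))
        (^ℚ-monoʳ-≤ (from-yes (1ℚ ℚ.≤? 40/27)) (∑-neighbour≤d w)))))
      (ℚ.≤-reflexive (trans (cong (⅓ ^ℚ d ℚ.*_)
          (trans (∑ℚ-cube-const d _) (sym (*-^ℚ (1ℚ ℚ.+ 1ℚ) 40/27 d))))
        (sym (*-^ℚ ⅓ ((1ℚ ℚ.+ 1ℚ) ℚ.* 40/27) d))))
    global-≤ : 10/11 ^ℚ (2 ^ d) ℚ.* (q ℚ.+ p ℚ.* c₂) ^ℚ (2 ^ d) ℚ.≤ 80/81 ^ℚ d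
    global-≤ = ℚ.≤-trans
      (ℚ.*-monoˡ-≤-nonNeg (10/11 ^ℚ (2 ^ d)) {{ℚ.nonNegative (0≤10/11^ (2 ^ d))}}
        (^ℚ-monoˡ-≤ (2 ^ d) (0≤base 0≤c₂)
          (ℚ.≤-trans (base-≤ (from-yes (1ℚ ℚ.≤? c₂)))
            (from-yes (1ℚ ℚ.+ 1/54 ℚ.* (c₂ ℚ.- 1ℚ) ℚ.≤? 88/81)))))
      (ℚ.≤-trans (ℚ.≤-reflexive (sym (*-^ℚ 10/11 88/81 (2 ^ d))))
        -- The doubly exponential decay is weakened to match the local error.
        (^ℚ-antiʳ-≤ (from-yes (0ℚ ℚ.≤? 80/81)) (from-yes (80/81 ℚ.≤? 1ℚ)) (n≤2^n d)))

  expansion-probability : ∀ {ε} → 80/81 ^ℚ d ℚ.+ 80/81 ^ℚ d ℚ.≤ ε →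
                          ProbAtLeast d q (GoodExpansion d) (1ℚ ℚ.- ε)
  expansion-probability {ε} small =
    -- The selected outcomes are those with the decidable property `Good`, which implies
    -- `GoodExpansion`.
    map (does ∘ good?) Ω , length-map (does ∘ good?) Ω ,
    subst (All (GoodExpansion d)) (sym (select-does good? Ω)) (All.tabulate (λ S∈ →
      good⇒expansion (proj₁ (∈-filter⁻ good? {xs = Ω} S∈)) (proj₂ (∈-filter⁻ good? {xs = Ω} S∈)))) ,
    ℚ.≤-trans lower (ℚ.≤-reflexive (sym (trans
      (cong (λ Ss → sumℚ (map (weight d q) Ss)) (select-does good? Ω))
      (sumℚ-map (weight d q) (filter good? Ω)))))
    where
    Ω = sublists (cube d)
    success : ℚ
    success = ∑ℚ (filter good? Ω) (weight d q)
    lower : 1ℚ ℚ.- ε ℚ.≤ success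
    lower = ℚ.≤-trans (ℚ.+-monoˡ-≤ (ℚ.- ε) (ℚ.≤-trans (ℚ.≤-reflexive (sym (total-weight d q)))
        (ℚ.≤-trans (markov good? (weight d q) charge 0≤weight
            (λ S → +-nonNeg (0≤local S) (0≤global S)) bad⇒1≤charge Ω)
          (ℚ.+-monoʳ-≤ success (ℚ.≤-trans charge-≤ small)))))
      (ℚ.≤-reflexive (solve 2 (λ s e → (s :+ e) :- e := s) refl success ε))

-- Vanishing of the error and partial sums of the exponential

ι : ℕ → ℚ
ι zero    = 0ℚ
ι (suc n) = 1ℚ ℚ.+ ι n

ι-mono-≤ : ∀ {m n} → m ≤ n → ι m ℚ.≤ ι n
ι-mono-≤ {n = n} z≤n = 0≤ι n
  where
  0≤ι : ∀ n → 0ℚ ℚ.≤ ι n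
  0≤ι zero    = ℚ.≤-refl
  0≤ι (suc n) = +-nonNeg (from-yes (0ℚ ℚ.≤? 1ℚ)) (0≤ι n)
ι-mono-≤ (s≤s m≤n) = ℚ.+-monoʳ-≤ 1ℚ (ι-mono-≤ m≤n)

toℚᵘ-ι : ∀ n → toℚᵘ (ι n) ℚᵘ.≃ ℚᵘ.mkℚᵘ (ℤ.+ n) 0
toℚᵘ-ι zero    = ℚᵘ.≃-refl
toℚᵘ-ι (suc n) = ℚᵘ.≃-trans (ℚ.toℚᵘ-homo-+ 1ℚ (ι n)) (ℚᵘ.≃-trans
  (ℚᵘ.+-congʳ (toℚᵘ 1ℚ) (toℚᵘ-ι n))
  (ℚᵘ.*≡* (cong (λ k → (ℤ.+ 1 ℤ.+ k) ℤ.* ℤ.+ 1) (ℤ.*-identityʳ (ℤ.+ n)))))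

-- For ε = (n + 1)/(m + 1) the witness k(m + 1) cancels the denominator, and k(n + 1) ≥ k remains.
archimedean : ∀ k {ε} → 0ℚ ℚ.< ε → ∃ λ D → ι k ℚ.≤ ι D ℚ.* ε
archimedean k {mkℚ (ℤ.+ zero)  m _} (ℚ.*<* 0<0) = contradiction 0<0 (ℤ.<-irrefl refl)
archimedean k {mkℚ (ℤ.+ suc n) m c} 0<ε = k * suc m , ℚ.toℚᵘ-cancel-≤ (begin
  toℚᵘ (ι k)
    ≃⟨ toℚᵘ-ι k ⟩
  ℚᵘ.mkℚᵘ (ℤ.+ k) 0
    ≤⟨ ℚᵘ.*≤* (subst₂ ℤ._≤_ (ℤ.pos-* k (1 * suc m))
         (trans (ℤ.pos-* (k * suc m * suc n) 1)
           (cong (ℤ._* ℤ.+ 1) (ℤ.pos-* (k * suc m) (suc n))))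
         (ℤ.+≤+ bound)) ⟩
  ℚᵘ.mkℚᵘ (ℤ.+ (k * suc m)) 0 ℚᵘ.* ℚᵘ.mkℚᵘ (ℤ.+ suc n) m
    ≃⟨ ℚᵘ.*-congʳ {toℚᵘ (mkℚ (ℤ.+ suc n) m c)} (toℚᵘ-ι (k * suc m)) ⟨
  toℚᵘ (ι (k * suc m)) ℚᵘ.* toℚᵘ (mkℚ (ℤ.+ suc n) m c)
    ≃⟨ ℚ.toℚᵘ-homo-* (ι (k * suc m)) (mkℚ (ℤ.+ suc n) m c) ⟨
  toℚᵘ (ι (k * suc m) ℚ.* mkℚ (ℤ.+ suc n) m c) ∎)
  where
  open ℚᵘ.≤-Reasoning
  bound : k * (1 * suc m) ≤ k * suc m * suc n * 1
  bound = ≤-trans (≤-reflexive (cong (k *_) (*-identityˡ (suc m))))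
    (≤-trans (m≤m*n (k * suc m) (suc n)) (≤-reflexive (sym (*-identityʳ _))))
archimedean k {mkℚ (ℤ.-[1+ n ]) m _} (ℚ.*<* ())

81/80 : ℚ
81/80 = ℤ.+ 81 ℚ./ 80

bernoulli : ∀ n → ι n ℚ.* (ℤ.+ 1 ℚ./ 80) ℚ.≤ 81/80 ^ℚ n
bernoulli zero    = from-yes (0ℚ ℚ.* (ℤ.+ 1 ℚ./ 80) ℚ.≤? 1ℚ)
bernoulli (suc n) = ℚ.≤-trans
  (ℚ.≤-reflexive (solve 1 (λ i →
    (con 1ℚ :+ i) :* con (ℤ.+ 1 ℚ./ 80) :=
    i :* con (ℤ.+ 1 ℚ./ 80) :+ con 1ℚ :* con (ℤ.+ 1 ℚ./ 80)) refl (ι n)))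
  (ℚ.≤-trans (ℚ.+-mono-≤ (bernoulli n) (ℚ.*-monoʳ-≤-nonNeg (ℤ.+ 1 ℚ./ 80)
      (1≤^ℚ n (from-yes (1ℚ ℚ.≤? 81/80)))))
    (ℚ.≤-reflexive (solve 1
      (λ x → x :+ x :* con (ℤ.+ 1 ℚ./ 80) := con (ℤ.+ 81 ℚ./ 80) :* x) refl (81/80 ^ℚ n))))
  where open +-*-Solver

-- Write x for the power and 2x as x · 160/80. The choice of D replaces 160 by dε, and `bernoulli`
-- bounds d/80 by (81/80)^d, the inverse of x.
decay : ∀ {ε} → 0ℚ ℚ.< ε → ∃ λ D → ∀ d → D ≤ d → 80/81 ^ℚ d ℚ.+ 80/81 ^ℚ d ℚ.≤ ε
decay {ε} 0<ε with archimedean 160 0<ε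
... | D , 160≤ = D , λ d D≤d → let x = 80/81 ^ℚ d ; 0≤x = ^ℚ-nonNeg d (from-yes (0ℚ ℚ.≤? 80/81)) in
  ℚ.≤-trans (ℚ.≤-reflexive (solve 1 (λ x → x :+ x := x :* con (ι 160) :* con (ℤ.+ 1 ℚ./ 80)) refl x))
  (ℚ.≤-trans (ℚ.*-monoʳ-≤-nonNeg (ℤ.+ 1 ℚ./ 80) (ℚ.*-monoˡ-≤-nonNeg x {{ℚ.nonNegative 0≤x}}
    (ℚ.≤-trans 160≤ (ℚ.*-monoʳ-≤-nonNeg ε {{ℚ.nonNegative (ℚ.<⇒≤ 0<ε)}} (ι-mono-≤ D≤d)))))
  (ℚ.≤-trans (ℚ.≤-reflexive (solve 3
    (λ x i e → x :* (i :* e) :* con (ℤ.+ 1 ℚ./ 80) := x :* (i :* con (ℤ.+ 1 ℚ./ 80)) :* e) refl x (ι d) ε))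
  (ℚ.≤-trans (ℚ.*-monoʳ-≤-nonNeg ε {{ℚ.nonNegative (ℚ.<⇒≤ 0<ε)}}
    (ℚ.*-monoˡ-≤-nonNeg x {{ℚ.nonNegative 0≤x}} (bernoulli d)))
  (ℚ.≤-reflexive (trans (cong (ℚ._* ε) (trans (sym (*-^ℚ 80/81 81/80 d)) (1^ℚ d))) (ℚ.*-identityˡ ε))))))
  where open +-*-Solver

expTerm-mono : ∀ {s t} → 0ℚ ℚ.≤ s → s ℚ.≤ t → ∀ k → 0ℚ ℚ.≤ expTerm s k × expTerm s k ℚ.≤ expTerm t k
expTerm-mono 0≤s s≤t zero    = from-yes (0ℚ ℚ.≤? 1ℚ) , ℚ.≤-refl
expTerm-mono {s} {t} 0≤s s≤t (suc k) with expTerm-mono 0≤s s≤t k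
... | 0≤e , e≤ = *-nonNeg 0≤e 0≤step ,
  *-mono-≤-nonNeg 0≤step (ℚ.≤-trans 0≤e e≤) e≤ (ℚ.*-monoʳ-≤-nonNeg 1/k {{0≤1/k}} s≤t)
  where
  1/k = ℤ.+ 1 ℚ./ suc k
  0≤1/k : ℚ.NonNegative 1/k
  0≤1/k = ℚ.normalize-nonNeg 1 (suc k)
  0≤step : 0ℚ ℚ.≤ s ℚ.* 1/k
  0≤step = *-nonNeg 0≤s (ℚ.nonNegative⁻¹ 1/k {{0≤1/k}})

expPartial-mono : ∀ {s t} → 0ℚ ℚ.≤ s → s ℚ.≤ t → ∀ n → expPartial s n ℚ.≤ expPartial t n
expPartial-mono 0≤s s≤t zero    = ℚ.≤-refl
expPartial-mono 0≤s s≤t (suc n) = ℚ.+-mono-≤ (expPartial-mono 0≤s s≤t n) (proj₂ (expTerm-mono 0≤s s≤t n))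

-- Monotonicity in t reduces this to t = 4. There e⁴ is about 54.6, and ten terms, about 54.15, are
-- the first to pass 54.
54≤expPartial : ∀ {t} → ℤ.+ 4 ℚ./ 1 ℚ.≤ t → ℤ.+ 54 ℚ./ 1 ℚ.≤ expPartial t 10
54≤expPartial {t} 4≤t = ℚ.≤-trans {j = expPartial (ℤ.+ 4 ℚ./ 1) 10}
  (from-yes (ℤ.+ 54 ℚ./ 1 ℚ.≤? expPartial (ℤ.+ 4 ℚ./ 1) 10))
  (expPartial-mono {ℤ.+ 4 ℚ./ 1} {t} (from-yes (0ℚ ℚ.≤? ℤ.+ 4 ℚ./ 1)) 4≤t 10)

theorem4p1 : (t : ℚ) → (ℤ.+ 4) ℚ./ 1 ℚ.≤ t →
  (q : ℕ → ℚ) → (∀ d → q d ℚ.≤ 1ℚ) → (∀ d → AboveOneMinusExpNeg t (q d)) →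
  ∀ (ε : ℚ) → 0ℚ ℚ.< ε →
  ∃ λ (D : ℕ) → ∀ (d : ℕ) → D ≤ d →
  ProbAtLeast d (q d) (GoodExpansion d) (1ℚ ℚ.- ε)
theorem4p1 t 4≤t q q≤1 above ε 0<ε = proj₁ (decay 0<ε) , λ d D≤d →
  Random.expansion-probability (q d) (q≤1 d) (rare (q≤1 d) (above d)) (proj₂ (decay 0<ε) d D≤d)
  where
  rare : ∀ {q} → q ℚ.≤ 1ℚ → AboveOneMinusExpNeg t q → (1ℚ ℚ.- q) ℚ.* (ℤ.+ 54 ℚ./ 1) ℚ.≤ 1ℚ
  rare {q} q≤1 above = ℚ.≤-trans
    (ℚ.*-monoˡ-≤-nonNeg (1ℚ ℚ.- q) {{ℚ.nonNegative (p≤q⇒0≤q-p q≤1)}} (54≤expPartial 4≤t)) (above 10)
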